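{- Let $\Gamma$ be the graph whose components are $s$ cycles of lengths $\ell_1,\ell_2,\dots,\ell_s\ge 3$ and one path of length $m$ (i.e. with $m$ edges), and let $I=\{i\mid 1\le i\le s,\ \ell_i \text{ is even}\}$. Put \[m_0=2|I|\max\{\ell_i+3\mid i\in I\}-1,\qquad m_1=7^{\,s-|I|-1}\max\{2\ell_i+1\mid i\notin I\}.\] Then $\Gamma$ has a graceful labeling whenever $m\ge 6\max(1,m_0)+7\max(3,m_1)+9$.
   Context: The maximum of an empty set of integers is taken to be $0$. For a graph with $\epsilon$ edges, a graceful labeling is an injective assignment of integers from $\{0,1,\dots,\epsilon\}$ to the vertices such that the absolute differences of the labels of the endpoints of the edges are exactly $1,2,\dots,\epsilon$ (each once). Here $\Gamma$ has $\epsilon=\sum_i\ell_i+m$ edges and $\epsilon+1$ vertices. -}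

module Defs where

open import Data.Nat.Base using (ℕ; zero; suc; _+_; _*_; _∸_; _^_; _≤_; _⊔_; ∣_-_∣; _%_; _≡ᵇ_)
open import Data.Bool.Base using (Bool; not)
open import Data.Fin.Base using (Fin)
open import Data.List.Base using (List; []; _∷_; _++_; [_]; map; concat; length; foldr; filterᵇ; upTo)
open import Data.Nat.ListAction using (sum)
open import Data.List.Relation.Unary.All using (All)
open import Data.List.Relation.Unary.Unique.Propositional using (Unique)
open import Data.List.Relation.Binary.Permutation.Propositional using (_↭_)
open import Data.Vec.Base using (Vec; toList)
open import Data.Fin.Base using ()
open import Data.List.Base using ()
open import Data.Product using (Σ; _×_)
import Data.List.Base as L
import Data.Vec.Functional as VF

values : {s : ℕ} → (Fin s → ℕ) → List ℕ
values {s} ℓ = VF.toList ℓ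

maxList : List ℕ → ℕ
maxList = foldr _⊔_ 0

isEven : ℕ → Bool
isEven n = n % 2 ≡ᵇ 0

pathDiffs : List ℕ → List ℕ
pathDiffs (a ∷ b ∷ r) = ∣ a - b ∣ ∷ pathDiffs (b ∷ r)
pathDiffs _ = []

cycleDiffs : List ℕ → List ℕ
cycleDiffs [] = []
cycleDiffs (a ∷ r) = pathDiffs ((a ∷ r) ++ [ a ])

-- Γ = C_{ℓ 0} ∪ … ∪ C_{ℓ (s-1)} ∪ P_m (path with m edges, m+1 vertices)
-- number of edges ε = Σ ℓ_i + m
numEdges : (s : ℕ) → (Fin s → ℕ) → ℕ → ℕ
numEdges s ℓ m = sum (values ℓ) + m

-- A labeling of Γ: cycle i gets labels C i (in cyclic vertex order),
-- the path gets labels P (in path order).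
allLabels : (s : ℕ) (ℓ : Fin s → ℕ) (m : ℕ) →
            ((i : Fin s) → Vec ℕ (ℓ i)) → Vec ℕ (suc m) → List ℕ
allLabels s ℓ m C P = concat (VF.toList (λ i → toList (C i))) ++ toList P

allDiffs : (s : ℕ) (ℓ : Fin s → ℕ) (m : ℕ) →
           ((i : Fin s) → Vec ℕ (ℓ i)) → Vec ℕ (suc m) → List ℕ
allDiffs s ℓ m C P = concat (VF.toList (λ i → cycleDiffs (toList (C i)))) ++ pathDiffs (toList P)

IsGraceful : (s : ℕ) (ℓ : Fin s → ℕ) (m : ℕ) →
             ((i : Fin s) → Vec ℕ (ℓ i)) → Vec ℕ (suc m) → Set
IsGraceful s ℓ m C P =
  Unique (allLabels s ℓ m C P) ×
  All (_≤ numEdges s ℓ m) (allLabels s ℓ m C P) ×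
  (allDiffs s ℓ m C P ↭ map suc (upTo (numEdges s ℓ m)))

HasGracefulLabeling : (s : ℕ) (ℓ : Fin s → ℕ) (m : ℕ) → Set
HasGracefulLabeling s ℓ m =
  Σ ((i : Fin s) → Vec ℕ (ℓ i)) λ C → Σ (Vec ℕ (suc m)) λ P → IsGraceful s ℓ m C P

evenLens oddLens : {s : ℕ} → (Fin s → ℕ) → List ℕ
evenLens ℓ = filterᵇ isEven (values ℓ)
oddLens ℓ = filterᵇ (λ n → not (isEven n)) (values ℓ)

m₀ : (s : ℕ) → (Fin s → ℕ) → ℕ
m₀ s ℓ = 2 * length (evenLens ℓ) * maxList (map (λ n → n + 3) (evenLens ℓ)) ∸ 1

m₁ : (s : ℕ) → (Fin s → ℕ) → ℕ
m₁ s ℓ = 7 ^ (s ∸ length (evenLens ℓ) ∸ 1) * maxList (map (λ n → 2 * n + 1) (oddLens ℓ))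

{-# OPTIONS --safe #-}
-- Order the N + 1 labels as 0, N, 1, N − 1, …; an edge between the positions u and v with u + v = 2c + 1
-- then has label difference N − c, so a graceful labeling becomes an arrangement of paths and cycles on
-- the positions 0, …, N whose centres c are 0, …, N − 1, each used once.  Only an odd cycle needs an edge
-- between positions of equal parity; such an edge {u , v} has difference |u − v| / 2.
-- A zigzag whose path ends at position s glues onto the outside of any arrangement whose path ends at
-- position s.  Even cycles sit in zigzags made of three interleaved strands of step 3.  An odd cycle is the
-- same three-strand cycle, opened at one edge and closed through a further vertex whose position is far
-- away, so that its one edge of equal parity has the smallest difference not used inside; this multiplies
-- the number of edges by about 5.  Path-only zigzags with ends s and t exist when s + 1 and t + 1 are
-- coprime (subtractive Euclidean algorithm), and since every integer is a sum of two units modulo an odd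
-- number, two of them adjust the path to any prescribed length.
module Submission where

open import Defs
open import Data.Empty using (⊥-elim)
open import Data.Fin.Base as Fin using (Fin)
open import Data.List.Base using (List; []; _∷_; _++_; [_]; map; concat; length; reverse; applyUpTo; filterᵇ)
open import Data.List.Properties
  using (map-++; length-map; length-++; length-reverse; length-tabulate; unfold-reverse; ++-assoc; map-id; map-∘; map-applyUpTo)
open import Data.List.Relation.Binary.Permutation.Propositional
  using (_↭_; refl; prep; swap; trans; ↭-sym; ↭-reflexive; ↭⇒↭ₛ; module PermutationReasoning)
open import Data.List.Relation.Binary.Permutation.Propositional.Properties
  using (++⁺; ++⁺ˡ; ++⁺ʳ; ++-comm; map⁺; ↭-reverse; ↭-length; All-resp-↭; ++-commutativeMonoid; shift; shifts)
import Data.List.Relation.Binary.Permutation.Setoid.Properties as Permutation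
open import Data.List.Relation.Unary.All as All using (All; []; _∷_)
import Data.List.Relation.Unary.All.Properties as All
open import Data.List.Relation.Unary.Unique.Propositional using (Unique)
open import Data.List.Relation.Unary.Unique.Propositional.Properties using (upTo⁺)
open import Data.Bool.Base using (true; false; not)
open import Data.Nat.Base
open import Data.Nat.Coprimality using (Coprime; coprime?; coprime-divisor; gcd≡1⇒coprime)
open import Data.Nat.Divisibility
open import Data.Nat.DivMod using (m≡m%n+[m/n]*n; m%n<n; [m+kn]%n≡m%n)
open import Data.Nat.GCD using (gcd; gcd[m,n]∣m; gcd[m,n]∣n)
open import Data.Nat.ListAction using (sum)
open import Data.Nat.ListAction.Properties using (sum-↭; sum-++)
open import Data.Nat.Properties
open import Data.Nat.Tactic.RingSolver using (solve-∀)
open import Data.Product using (Σ; _×_; _,_; ∃-syntax)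
open import Data.Sum.Base using (inj₁; inj₂)
open import Data.Vec.Base using (Vec; toList; fromList)
import Data.Vec.Functional as VF
open import Data.Vec.Properties using (toList∘fromList)
open import Function.Base using (_∘_)
open import Relation.Binary.Definitions using (tri<; tri≈; tri>)
open import Relation.Binary.PropositionalEquality
  using (_≡_; refl; sym; cong; cong₂; subst; subst₂; setoid) renaming (trans to infixr 5 _∙_)
open import Relation.Nullary using (yes; no)
import Algebra.Solver.CommutativeMonoid

module CM = Algebra.Solver.CommutativeMonoid (++-commutativeMonoid {A = ℕ})
open CM using (_⊕_; _⊜_)

-- Intervals of naturals as lists

range : ℕ → ℕ → List ℕ
range a zero    = []
range a (suc n) = a ∷ range (suc a) n

length-range : ∀ a n → length (range a n) ≡ n
length-range a zero    = refl
length-range a (suc n) = cong suc (length-range (suc a) n)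

range-++ : ∀ a m n → range a (m + n) ≡ range a m ++ range (a + m) n
range-++ a zero    n = cong (λ b → range b n) (sym (+-identityʳ a))
range-++ a (suc m) n = cong (a ∷_) (range-++ (suc a) m n ∙
  cong (λ b → range (suc a) m ++ range b n) (sym (+-suc a m)))

map-+-range : ∀ k a n → map (k +_) (range a n) ≡ range (k + a) n
map-+-range k a zero    = refl
map-+-range k a (suc n) = cong (k + a ∷_) (map-+-range k (suc a) n ∙
  cong (λ b → range b n) (+-suc k a))

range-≤ : ∀ a n → All (_< a + n) (range a n)
range-≤ a zero    = []
range-≤ a (suc n) = m<m+n a z<s ∷
  subst (λ b → All (_< b) (range (suc a) n)) (sym (+-suc a n)) (range-≤ (suc a) n)

bounded : ∀ {n vs} → vs ↭ range 0 (suc n) → All (_≤ n) vs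
bounded {n} p = All-resp-↭ (↭-sym p) (All.map s≤s⁻¹ (range-≤ 0 (suc n)))

-- Walks, cycles and layouts

-- `R x y c` reads: an edge joins the positions `x` and `y` and has centre `c`. Leaving `R` open
-- lets one set of lemmas serve both `Centre` and `Edge n`.
Rel₃ : Set₁
Rel₃ = ℕ → ℕ → ℕ → Set

data Walk (R : Rel₃) : ℕ → ℕ → List ℕ → List ℕ → Set where
  stop : ∀ {x} → Walk R x x (x ∷ []) []
  step : ∀ {x y z c vs cs} → R x y c → Walk R y z vs cs → Walk R x z (x ∷ vs) (c ∷ cs)

data Cycles (R : Rel₃) : List ℕ → List ℕ → List ℕ → Set where
  []  : Cycles R [] [] []
  add : ∀ {x y c l vs cs ls ws ds} → Walk R x y vs cs → R y x c → length vs ≡ l →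
        Cycles R ls ws ds → Cycles R (l ∷ ls) (vs ++ ws) ((c ∷ cs) ++ ds)

Symmetric₃ : Rel₃ → Set
Symmetric₃ R = ∀ {x y c} → R x y c → R y x c

module _ {R : Rel₃} where

  join : ∀ {x y z w c vs cs ws ds} → Walk R x y vs cs → R y z c → Walk R z w ws ds →
         Walk R x w (vs ++ ws) (cs ++ c ∷ ds)
  join stop       r q = step r q
  join (step s p) r q = step s (join p r q)

  walk-reverse : Symmetric₃ R → ∀ {x y vs cs} → Walk R x y vs cs → Walk R y x (reverse vs) (reverse cs)
  walk-reverse R-sym stop = stop
  walk-reverse R-sym {x} (step {c = c} {vs} {cs} r p) =
    subst₂ (Walk R _ _) (sym (unfold-reverse x vs)) (sym (unfold-reverse c cs))
      (join (walk-reverse R-sym p) (R-sym r) stop)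

  walk-≡ : ∀ {x x′ y y′ vs vs′ cs cs′} → x ≡ x′ → y ≡ y′ → vs ≡ vs′ → cs ≡ cs′ →
           Walk R x y vs cs → Walk R x′ y′ vs′ cs′
  walk-≡ refl refl refl refl p = p

  walk-map : ∀ {S : Rel₃} (f g : ℕ → ℕ) → (∀ {x y c} → R x y c → S (f x) (f y) (g c)) →
             ∀ {x y vs cs} → Walk R x y vs cs → Walk S (f x) (f y) (map f vs) (map g cs)
  walk-map f g h stop       = stop
  walk-map f g h (step r p) = step (h r) (walk-map f g h p)

  walk-head : ∀ {P : ℕ → Set} {x y vs cs} → Walk R x y vs cs → All P vs → P x
  walk-head stop       (px ∷ _) = px
  walk-head (step _ _) (px ∷ _) = px

  walk-last : ∀ {P : ℕ → Set} {x y vs cs} → Walk R x y vs cs → All P vs → P y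
  walk-last stop       (px ∷ _)  = px
  walk-last (step _ p) (_ ∷ pxs) = walk-last p pxs

  walk-lift : ∀ {S : Rel₃} {P : ℕ → Set} → (∀ {x y c} → P x → P y → R x y c → S x y c) →
              ∀ {x y vs cs} → Walk R x y vs cs → All P vs → Walk S x y vs cs
  walk-lift h stop       _          = stop
  walk-lift h (step r p) (px ∷ pxs) = step (h px (walk-head p pxs) r) (walk-lift h p pxs)

  cycles-map : ∀ {S : Rel₃} (f g : ℕ → ℕ) → (∀ {x y c} → R x y c → S (f x) (f y) (g c)) →
               ∀ {ls vs cs} → Cycles R ls vs cs → Cycles S ls (map f vs) (map g cs)
  cycles-map f g h [] = []
  cycles-map {S} f g h (add {c = c} {l} {vs} {cs} {ls} {ws} {ds} p r e q) =
    subst₂ (Cycles S (l ∷ ls)) (sym (map-++ f vs ws)) (sym (map-++ g (c ∷ cs) ds))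
      (add (walk-map f g h p) (h r) (length-map f vs ∙ e) (cycles-map f g h q))

  cycles-lift : ∀ {S : Rel₃} {P : ℕ → Set} → (∀ {x y c} → P x → P y → R x y c → S x y c) →
                ∀ {ls vs cs} → Cycles R ls vs cs → All P vs → Cycles S ls vs cs
  cycles-lift h [] _ = []
  cycles-lift h (add {vs = vs} p r e q) pxs =
    let pvs = All.++⁻ˡ vs pxs in
    add (walk-lift h p pvs) (h (walk-last p pvs) (walk-head p pvs) r) e (cycles-lift h q (All.++⁻ʳ vs pxs))

  cycles-++ : ∀ {ls vs cs ls′ vs′ cs′} → Cycles R ls vs cs → Cycles R ls′ vs′ cs′ →
              Cycles R (ls ++ ls′) (vs ++ vs′) (cs ++ cs′)
  cycles-++ [] q = q
  cycles-++ {vs′ = vs′} {cs′} (add {c = c} {vs = vs} {cs} {ls} {ws} {ds} p r e q₁) q =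
    subst₂ (Cycles R _) (sym (++-assoc vs ws vs′)) (sym (++-assoc (c ∷ cs) ds cs′))
      (add p r e (cycles-++ q₁ q))

  cycles-↭ : ∀ {ls ls′ vs cs} → ls ↭ ls′ → Cycles R ls vs cs →
             ∃[ vs′ ] ∃[ cs′ ] Cycles R ls′ vs′ cs′ × vs ↭ vs′ × cs ↭ cs′
  cycles-↭ refl q = _ , _ , q , refl , refl
  cycles-↭ (prep _ π) (add {c = c} {vs = vs} {cs} p r e q) with cycles-↭ π q
  ... | _ , _ , q′ , v , d = _ , _ , add p r e q′ , ++⁺ˡ vs v , ++⁺ˡ (c ∷ cs) d
  cycles-↭ (swap _ _ π) (add {c = c} {vs = vs} {cs} p r e (add {c = c₁} {vs = vs₁} {cs₁} p₁ r₁ e₁ q))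
    with cycles-↭ π q
  ... | _ , _ , q′ , v , d = _ , _ , add p₁ r₁ e₁ (add p r e q′)
    , trans (++⁺ˡ vs (++⁺ˡ vs₁ v)) (shifts vs vs₁)
    , trans (++⁺ˡ (c ∷ cs) (++⁺ˡ (c₁ ∷ cs₁) d)) (shifts (c ∷ cs) (c₁ ∷ cs₁))
  cycles-↭ (trans π ρ) q with cycles-↭ π q
  ... | _ , _ , q′ , v , d with cycles-↭ ρ q′
  ... | _ , _ , q″ , v′ , d′ = _ , _ , q″ , trans v v′ , trans d d′

record Layout (R : Rel₃) (ls : List ℕ) (n s t : ℕ) : Set where
  constructor layout
  field
    {cv cc pv pc} : List ℕ
    cycles   : Cycles R ls cv cc
    path     : Walk R s t pv pc
    vertices : cv ++ pv ↭ range 0 (suc n)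
    centres  : cc ++ pc ↭ range 0 n

layout-≡ : ∀ {R ls n n′ s s′ t t′} → n ≡ n′ → s ≡ s′ → t ≡ t′ → Layout R ls n s t → Layout R ls n′ s′ t′
layout-≡ refl refl refl L = L

layout-↭ : ∀ {R ls ls′ n s t} → ls ↭ ls′ → Layout R ls n s t → Layout R ls′ n s t
layout-↭ π (layout q p v d) with cycles-↭ π q
... | _ , _ , q′ , v′ , d′ = layout q′ p (trans (++⁺ʳ _ (↭-sym v′)) v) (trans (++⁺ʳ _ (↭-sym d′)) d)

layout-reverse : ∀ {R ls n s t} → Symmetric₃ R → Layout R ls n s t → Layout R ls n t s
layout-reverse R-sym (layout {cv} {cc} {pv} {pc} q p v d) =
  layout q (walk-reverse R-sym p) (trans (++⁺ˡ cv (↭-reverse pv)) v) (trans (++⁺ˡ cc (↭-reverse pc)) d)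

-- Zigzags

record Centre (x y c : ℕ) : Set where
  constructor centre
  field midpoint : x + y ≡ suc (c + c)

Centre-sym : Symmetric₃ Centre
Centre-sym {x} {y} (centre e) = centre (+-comm y x ∙ e)

Centre-shift : ∀ k {x y c} → Centre x y c → Centre (k + x) (k + y) (k + c)
Centre-shift k {x} {y} {c} (centre e) = centre (h k x y ∙ cong (k + k +_) e ∙ h′ k c)
  where
  h : ∀ k x y → k + x + (k + y) ≡ k + k + (x + y)
  h = solve-∀
  h′ : ∀ k c → k + k + suc (c + c) ≡ suc (k + c + (k + c))
  h′ = solve-∀

-- Adding `x + y = 2c + 1` over all edges of an arrangement on `0, …, n` gives
-- `n (n + 1) − s − t = n²`, so the ends force the size `s + t`.
Zigzag : List ℕ → ℕ → ℕ → Set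
Zigzag ls s t = Layout Centre ls (s + t) s t

++-range : ∀ {xs ys} m n → xs ↭ range 0 m → ys ↭ range 0 n → xs ++ map (m +_) ys ↭ range 0 (m + n)
++-range m n p q = trans (++⁺ p (map⁺ (m +_) q))
  (↭-reflexive (cong (range 0 m ++_) (map-+-range m 0 n ∙ cong (λ b → range b n) (+-identityʳ m)) ∙
    sym (range-++ 0 m n)))

-- The outer centres stop just before `s + t`, and the shifted inner ones start at `k = s + t + 1`.
-- The edge from `t` to `k + s` has exactly the missing centre `s + t`. Two relations occur because
-- `R` may be `Edge n` while `S` is `Edge (k + n)`.
glue : ∀ {R S : Rel₃} {ls ls′ n s t ω} → let k = suc (s + t) in
       (∀ {x y c} → R x y c → S (k + x) (k + y) (k + c)) →
       (∀ {x y c} → x ≤ k + n → y ≤ k + n → Centre x y c → S x y c) →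
       Zigzag ls s t → Layout R ls′ n s ω → Layout S (ls ++ ls′) (k + n) s (k + ω)
glue {R} {S} {n = n} {s} {t} up lift (layout {cv} {cc} {pv} {pc} q p v d) (layout {cv′} {cc′} {pv′} {pc′} q′ p′ v′ d′) =
  layout (cycles-++ (cycles-lift lift q (All.++⁻ˡ cv b)) (cycles-map (k +_) (k +_) up q′))
    (join (walk-lift lift p (All.++⁻ʳ cv b)) link (walk-map (k +_) (k +_) up p′))
    (trans (CM.solve 4 (λ a b c d → (a ⊕ b) ⊕ (c ⊕ d) ⊜ (a ⊕ c) ⊕ (b ⊕ d)) refl
              cv (map (k +_) cv′) pv (map (k +_) pv′))
      (trans (↭-reflexive (cong ((cv ++ pv) ++_) (sym (map-++ (k +_) cv′ pv′))))
        (trans (++-range k (suc n) v v′) (↭-reflexive (cong (range 0) (+-suc k n))))))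
    (trans (CM.solve 5 (λ a b c d e → (a ⊕ b) ⊕ (c ⊕ (e ⊕ d)) ⊜ (e ⊕ (a ⊕ c)) ⊕ (b ⊕ d)) refl
              cc (map (k +_) cc′) pc (map (k +_) pc′) [ s + t ])
      (trans (↭-reflexive (cong ((s + t ∷ (cc ++ pc)) ++_) (sym (map-++ (k +_) cc′ pc′))))
        (++-range k n d″ d′)))
  where
  k : ℕ
  k = suc (s + t)
  b : All (_≤ k + n) (cv ++ pv)
  b = All.map (λ x≤ → ≤-trans (m≤n⇒m≤1+n x≤) (m≤m+n k n)) (bounded v)
  s≤n : s ≤ n
  s≤n = walk-head p′ (All.++⁻ʳ cv′ (bounded v′))
  link : S t (k + s) (s + t)
  link = lift (walk-last p (All.++⁻ʳ cv b)) (+-monoʳ-≤ k s≤n) (centre (h s t))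
    where
    h : ∀ s t → t + suc (s + t + s) ≡ suc (s + t + (s + t))
    h = solve-∀
  d″ : s + t ∷ (cc ++ pc) ↭ range 0 k
  d″ = trans (prep _ d) (trans (++-comm [ s + t ] (range 0 (s + t)))
    (↭-reflexive (sym (range-++ 0 (s + t) 1) ∙ cong (range 0) (+-comm (s + t) 1))))

stack : ∀ {ls ls′ s t t′} → Zigzag ls s t → Zigzag ls′ s t′ → Zigzag (ls ++ ls′) s (suc (s + t) + t′)
stack {s = s} {t} {t′} a b = layout-≡ (h s t t′) refl refl
  (glue (Centre-shift (suc (s + t))) (λ _ _ e → e) a b)
  where
  h : ∀ s t t′ → suc (s + t) + (s + t′) ≡ s + (suc (s + t) + t′)
  h = solve-∀

flip : ∀ {ls s t} → Zigzag ls s t → Zigzag ls t s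
flip {s = s} {t} a = layout-≡ (+-comm s t) refl refl (layout-reverse Centre-sym a)

ascend : ∀ a n → Walk Centre a (a + n) (range a (suc n)) (range a n)
ascend a zero    = subst (λ b → Walk Centre a b (a ∷ []) []) (sym (+-identityʳ a)) stop
ascend a (suc n) = step (centre (+-suc a a))
  (subst (λ b → Walk Centre (suc a) b (range (suc a) (suc n)) (range (suc a) n)) (sym (+-suc a n)) (ascend (suc a) n))

run : ∀ t → Zigzag [] 0 t
run t = layout [] (ascend 0 t) refl refl

spiral : ∀ s → Zigzag [] s 0
spiral s = flip (run s)

-- Stacking `spiral s` outside a zigzag with ends `s` and `r` adds `s + 1` to `r + 1`, which undoes
-- one subtraction of the Euclidean algorithm on `s + 1` and `t + 1`. `b` only bounds the recursion.
zigzag-coprime : ∀ b s t → s + t ≤ b → Coprime (suc s) (suc t) → Zigzag [] s t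
zigzag-coprime b s t s+t≤b cop with <-cmp s t
-- Equal ends are coprime to each other only if `suc s` is 1.
... | tri≈ _ refl _ with refl ← cop {suc s} (∣-refl , ∣-refl) = run 0
zigzag-coprime zero s (suc t) s+t≤b cop | tri< _ _ _ with () ← subst (_≤ 0) (+-suc s t) s+t≤b
zigzag-coprime (suc b) s (suc t) s+t≤b cop | tri< s<t _ _ with r , refl ← m≤n⇒∃[o]m+o≡n (s≤s⁻¹ s<t) =
  layout-≡ (cong (s +_) e) refl e
    (stack (spiral s) (zigzag-coprime b s r
      (≤-trans (+-monoʳ-≤ s (m≤n+m r s)) (s≤s⁻¹ (subst (_≤ suc b) (+-suc s (s + r)) s+t≤b)))
      λ {d} (p , q) → cop {d} (p , subst (d ∣_) (+-suc (suc s) r) (∣m∣n⇒∣m+n p q))))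
  where
  e : suc (s + 0) + r ≡ suc (s + r)
  e = cong (λ x → suc x + r) (+-identityʳ s)
zigzag-coprime zero (suc s) t () cop | tri> _ _ _
zigzag-coprime (suc b) (suc s) t s+t≤b cop | tri> _ _ t<s with r , refl ← m≤n⇒∃[o]m+o≡n (s≤s⁻¹ t<s) =
  flip (layout-≡ (cong (t +_) e) refl e
    (stack (spiral t) (zigzag-coprime b t r
      (≤-trans (+-monoʳ-≤ t (m≤n+m r t)) (≤-trans (≤-reflexive (+-comm t (t + r))) (s≤s⁻¹ s+t≤b)))
      λ {d} (p , q) → cop {d} (subst (d ∣_) (+-suc (suc t) r) (∣m∣n⇒∣m+n p q) , p))))
  where
  e : suc (t + 0) + r ≡ suc (t + r)
  e = cong (λ x → suc x + r) (+-identityʳ t)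

-- Strands of step 3 and even cycles

strand : ℕ → ℕ → List ℕ
strand a zero    = []
strand a (suc k) = a ∷ strand (3 + a) k

length-strand : ∀ a k → length (strand a k) ≡ k
length-strand a zero    = refl
length-strand a (suc k) = cong suc (length-strand (3 + a) k)

private
  3-swap : ∀ k a → k * 3 + (3 + a) ≡ 3 + (k * 3 + a)
  3-swap = solve-∀

strand-∷ʳ : ∀ a k → strand a (suc k) ≡ strand a k ++ [ k * 3 + a ]
strand-∷ʳ a zero    = refl
strand-∷ʳ a (suc k) = cong (a ∷_) (strand-∷ʳ (3 + a) k ∙ cong (λ b → strand (3 + a) k ++ [ b ]) (3-swap k a))

-- Since `a + (3 + a) = 2 (a + 1) + 1`, the centres of a strand form a strand of the next residue
-- class modulo 3. Three interleaved strands thus never compete for a centre.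
strand-walk : ∀ a k → Walk Centre a (k * 3 + a) (strand a (suc k)) (strand (suc a) k)
strand-walk a zero    = stop
strand-walk a (suc k) = step (centre (h a)) (walk-≡ refl (3-swap k a) refl refl (strand-walk (3 + a) k))
  where
  h : ∀ a → a + (3 + a) ≡ suc (suc a + suc a)
  h = solve-∀

strands-↭ : ∀ a k → strand a k ++ strand (1 + a) k ++ strand (2 + a) k ↭ range a (k * 3)
strands-↭ a zero    = refl
strands-↭ a (suc k) = trans
  (CM.solve 6 (λ x y z u v w → (x ⊕ u) ⊕ ((y ⊕ v) ⊕ (z ⊕ w)) ⊜ x ⊕ (y ⊕ (z ⊕ (u ⊕ (v ⊕ w))))) refl
    [ a ] [ 1 + a ] [ 2 + a ] (strand (3 + a) k) (strand (4 + a) k) (strand (5 + a) k))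
  (prep _ (prep _ (prep _ (strands-↭ (3 + a) k))))

-- Up the strand from `a` and back down the strand from `a + 1`: the ends are adjacent positions, so
-- an edge with centre `a` can close the walk to a cycle.
cap : ∀ a k → Walk Centre a (suc a)
  (strand a (suc k) ++ reverse (strand (suc a) (suc k)))
  (strand (suc a) k ++ k * 3 + a ∷ reverse (strand (2 + a) k))
cap a k = join (strand-walk a k) (centre (h k a)) (walk-reverse Centre-sym (strand-walk (suc a) k))
  where
  h : ∀ k a → k * 3 + a + (k * 3 + suc a) ≡ suc (k * 3 + a + (k * 3 + a))
  h = solve-∀

length-cap : ∀ a k → length (strand a (suc k) ++ reverse (strand (suc a) (suc k))) ≡ suc k + suc k
length-cap a k = length-++ (strand a (suc k)) ∙
  cong₂ _+_ (length-strand a (suc k)) (length-reverse (strand (suc a) (suc k)) ∙ length-strand (suc a) (suc k))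

range-last : ∀ a n → range a n ++ [ a + n ] ≡ range a (suc n)
range-last a n = sym (range-++ a n 1) ∙ cong (range a) (+-comm n 1)

-- The cycle takes the strands from 0 and 1, the path the strand from 2. The closing edge has centre
-- 0, and the centre `m` of the turn completes the path's centres to a full strand from 3.
even-cycle : ∀ k → Zigzag [ (2 + k) + (2 + k) ] 2 (2 + k * 3)
even-cycle k = layout (add (cap 0 (suc k)) (centre refl) (length-cap 0 (suc k)) [])
  (walk-≡ refl (+-comm (k * 3) 2) refl refl (strand-walk 2 k)) vs cs
  where
  open PermutationReasoning
  K m : ℕ
  K = suc k
  m = K * 3 + 0
  m≡ : m ≡ K * 3
  m≡ = +-identityʳ (K * 3)
  vs : ((strand 0 (suc K) ++ reverse (strand 1 (suc K))) ++ []) ++ strand 2 K ↭ range 0 (suc (2 + (2 + k * 3)))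
  vs = begin
    ((strand 0 (suc K) ++ reverse (strand 1 (suc K))) ++ []) ++ strand 2 K
      ≡⟨ cong₂ (λ x y → ((x ++ y) ++ []) ++ strand 2 K) (strand-∷ʳ 0 K) refl ⟩
    (((strand 0 K ++ [ m ]) ++ reverse (strand 1 (suc K))) ++ []) ++ strand 2 K
      ↭⟨ ++⁺ʳ (strand 2 K) (++⁺ʳ [] (++⁺ˡ (strand 0 K ++ [ m ]) (trans (↭-reverse _) (↭-reflexive (strand-∷ʳ 1 K))))) ⟩
    (((strand 0 K ++ [ m ]) ++ (strand 1 K ++ [ K * 3 + 1 ])) ++ []) ++ strand 2 K
      ↭⟨ CM.solve 5 (λ x y z u v → (((x ⊕ u) ⊕ (y ⊕ v)) ⊕ CM.id) ⊕ z ⊜ (x ⊕ (y ⊕ z)) ⊕ (u ⊕ v)) refl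
           (strand 0 K) (strand 1 K) (strand 2 K) [ m ] [ K * 3 + 1 ] ⟩
    (strand 0 K ++ strand 1 K ++ strand 2 K) ++ (m ∷ K * 3 + 1 ∷ [])
      ↭⟨ ++⁺ʳ _ (strands-↭ 0 K) ⟩
    range 0 (K * 3) ++ (m ∷ K * 3 + 1 ∷ [])
      ≡⟨ cong (range 0 (K * 3) ++_) (cong₂ (λ x y → x ∷ y ∷ []) m≡ (+-comm (K * 3) 1)) ⟩
    range 0 (K * 3) ++ range (K * 3) 2
      ≡⟨ sym (range-++ 0 (K * 3) 2) ∙ cong (range 0) (+-comm (K * 3) 2) ⟩
    range 0 (suc (2 + (2 + k * 3))) ∎
  cs : (0 ∷ (strand 1 K ++ m ∷ reverse (strand 2 K)) ++ []) ++ strand 3 k ↭ range 0 (2 + (2 + k * 3))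
  cs = begin
    (0 ∷ (strand 1 K ++ m ∷ reverse (strand 2 K)) ++ []) ++ strand 3 k
      ↭⟨ CM.solve 5 (λ x y z u v → (u ⊕ ((x ⊕ (v ⊕ y)) ⊕ CM.id)) ⊕ z ⊜ u ⊕ (x ⊕ (y ⊕ (z ⊕ v)))) refl
           (strand 1 K) (reverse (strand 2 K)) (strand 3 k) [ 0 ] [ m ] ⟩
    0 ∷ strand 1 K ++ reverse (strand 2 K) ++ strand 3 k ++ [ m ]
      ↭⟨ prep 0 (++⁺ˡ (strand 1 K) (++⁺ (↭-reverse (strand 2 K)) (↭-reflexive
           (cong (λ x → strand 3 k ++ [ x ]) (m≡ ∙ +-comm 3 (k * 3)) ∙ sym (strand-∷ʳ 3 k))))) ⟩
    0 ∷ strand 1 K ++ strand 2 K ++ strand 3 K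
      ↭⟨ prep 0 (strands-↭ 1 K) ⟩
    range 0 (2 + (2 + k * 3)) ∎

-- `zigzag-coprime` misses the far ends for which 3 divides `t + 4`. Stacking two zigzags with ends
-- 2 and 1 gives the first of these, 5, and `spiral 2` raises any far end by 3.
zigzag₂ : ∀ t → Zigzag [] 2 (3 + t)
zigzag₂ 0 = stack (spiral 2) (spiral 2)
zigzag₂ 1 = stack (spiral 2) (flip (stack (spiral 1) (spiral 1)))
zigzag₂ 2 = stack z z
  where
  z : Zigzag [] 2 1
  z = flip (stack (spiral 1) (spiral 1))
zigzag₂ (suc (suc (suc t))) = stack (spiral 2) (zigzag₂ t)

EvenCycle OddCycle : ℕ → Set
EvenCycle l = ∃[ k ] l ≡ (2 + k) + (2 + k)
OddCycle l  = ∃[ k ] l ≡ suc (suc k + suc k)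

even-cycles : ∀ {ls} → All EvenCycle ls → ∀ t → Zigzag ls 2 (3 + (2 * sum ls + t))
even-cycles [] t = zigzag₂ t
-- A cycle of length `2k + 4` moves the far end by `3k + 5`; the surplus `3 + k` up to twice its
-- length is passed on to the remaining zigzag.
even-cycles {_ ∷ ls} ((k , refl) ∷ es) t = layout-≡ (cong (2 +_) (h k (sum ls) t)) refl (h k (sum ls) t)
  (stack (even-cycle k) (even-cycles es (3 + k + t)))
  where
  h : ∀ k n t → suc (2 + (2 + k * 3)) + (3 + (2 * n + (3 + k + t))) ≡ 3 + (2 * ((2 + k) + (2 + k) + n) + t)
  h = solve-∀

-- The sequence `0, n, 1, n − 1, …`, written so that dropping the first position complements the
-- remaining labels. Shifting positions therefore preserves label differences.
lab : ℕ → ℕ → ℕ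
lab n       zero    = 0
lab zero    (suc j) = 0
lab (suc n) (suc j) = suc n ∸ lab n j

lab-≤ : ∀ n j → lab n j ≤ n
lab-≤ n       zero    = z≤n
lab-≤ zero    (suc j) = z≤n
lab-≤ (suc n) (suc j) = m∸n≤m (suc n) (lab n j)

-- Labels of positions

∸-∸-cancel : ∀ n a b → b ≤ n → (n ∸ a) ∸ (n ∸ b) ≡ b ∸ a
∸-∸-cancel n a b b≤n = ∸-+-assoc n a (n ∸ b) ∙ cong (n ∸_) (+-comm a (n ∸ b)) ∙
  sym (∸-+-assoc n (n ∸ b) a) ∙ cong (_∸ a) (m∸[m∸n]≡n b≤n)

∸-isometry : ∀ n {a b} → a ≤ n → b ≤ n → ∣ n ∸ a - n ∸ b ∣ ≡ ∣ a - b ∣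
∸-isometry n {a} {b} a≤n b≤n with ≤-total a b
... | inj₁ a≤b = m≤n⇒∣n-m∣≡n∸m (∸-monoʳ-≤ n a≤b) ∙ ∸-∸-cancel n a b b≤n ∙ sym (m≤n⇒∣m-n∣≡n∸m a≤b)
... | inj₂ b≤a = m≤n⇒∣m-n∣≡n∸m (∸-monoʳ-≤ n b≤a) ∙ ∸-∸-cancel n b a a≤n ∙ sym (m≤n⇒∣n-m∣≡n∸m b≤a)

lab-suc-suc : ∀ n j → lab (2 + n) (2 + j) ≡ suc (lab n j)
lab-suc-suc n j = +-∸-assoc 1 (m∸n≤m (suc n) (lab n j)) ∙ cong suc (m∸[m∸n]≡n (m≤n⇒m≤1+n (lab-≤ n j)))

lab-even : ∀ n i → i + i ≤ n → lab n (i + i) ≡ i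
lab-even n       zero    _ = refl
lab-even (suc n) (suc i) p rewrite +-suc i i with n | p
... | zero  | s≤s ()
... | suc n | s≤s (s≤s p) = lab-suc-suc n (i + i) ∙ cong suc (lab-even n i p)

lab-odd : ∀ n i → suc (i + i) ≤ n → lab n (suc (i + i)) ≡ n ∸ i
lab-odd (suc n) i (s≤s p) = cong (suc n ∸_) (lab-even n i p)

∸-↭ : ∀ n → map (n ∸_) (range 0 n) ↭ range 1 n
∸-↭ zero    = refl
∸-↭ (suc n) = begin
  suc n ∷ map (suc n ∸_) (range 1 n)
    ≡⟨ cong (suc n ∷_) (cong (map (suc n ∸_)) (sym (map-+-range 1 0 n)) ∙ sym (map-∘ (range 0 n))) ⟩
  suc n ∷ map (n ∸_) (range 0 n)  ↭⟨ prep _ (∸-↭ n) ⟩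
  suc n ∷ range 1 n               ↭⟨ ++-comm [ suc n ] (range 1 n) ⟩
  range 1 n ++ [ suc n ]          ≡⟨ range-last 1 n ⟩
  range 1 (suc n)                 ∎
  where open PermutationReasoning

lab-↭ : ∀ n → map (lab n) (range 0 (suc n)) ↭ range 0 (suc n)
lab-↭ zero    = refl
lab-↭ (suc n) = prep 0 (begin
  map (lab (suc n)) (range 1 (suc n))
    ≡⟨ cong (map (lab (suc n))) (sym (map-+-range 1 0 (suc n))) ∙ sym (map-∘ (range 0 (suc n))) ∙ map-∘ (range 0 (suc n)) ⟩
  map (suc n ∸_) (map (lab n) (range 0 (suc n)))  ↭⟨ map⁺ (suc n ∸_) (lab-↭ n) ⟩
  map (suc n ∸_) (range 0 (suc n))                ↭⟨ ∸-↭ (suc n) ⟩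
  range 1 (suc n)                                 ∎)
  where open PermutationReasoning

-- Here `c` need not be a midpoint: it encodes the difference `n ∸ c`, so that edges of equal parity
-- fit into the same layouts. The bounds are kept because `lab n` means nothing beyond `n`.
record Edge (n x y c : ℕ) : Set where
  constructor edge
  field
    x≤n  : x ≤ n
    y≤n  : y ≤ n
    diff : ∣ lab n x - lab n y ∣ ≡ n ∸ c

Edge-sym : ∀ {n} → Symmetric₃ (Edge n)
Edge-sym {n} {x} {y} (edge p q e) = edge q p (∣-∣-comm (lab n y) (lab n x) ∙ e)

Edge-shift : ∀ k {n x y c} → Edge n x y c → Edge (k + n) (k + x) (k + y) (k + c)
Edge-shift zero    e = e
Edge-shift (suc k) {n} {x} {y} {c} e with edge p q d ← Edge-shift k e =
  edge (s≤s p) (s≤s q) (∸-isometry (suc (k + n)) (m≤n⇒m≤1+n (lab-≤ (k + n) (k + x))) (m≤n⇒m≤1+n (lab-≤ (k + n) (k + y))) ∙ d)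

data ParityView : ℕ → Set where
  even : ∀ i → ParityView (i + i)
  odd  : ∀ i → ParityView (suc (i + i))

parityView : ∀ n → ParityView n
parityView zero = even 0
parityView (suc n) with parityView n
... | even i = odd i
... | odd i  = subst ParityView (cong suc (+-suc i i)) (even (suc i))

double-injective : ∀ i j → i + i ≡ j + j → i ≡ j
double-injective zero    zero    e = refl
double-injective (suc i) (suc j) e =
  cong suc (double-injective i j (suc-injective (sym (+-suc i i) ∙ suc-injective e ∙ +-suc j j)))

even-odd-absurd : ∀ i j → i + i ≡ suc (j + j) → ∀ {A : Set} → A
even-odd-absurd zero    j       ()
even-odd-absurd (suc i) zero    e with () ← subst (λ m → suc m ≡ 1) (+-suc i i) e
even-odd-absurd (suc i) (suc j) e = even-odd-absurd i j (suc-injective (sym (+-suc i i) ∙ suc-injective e ∙ cong suc (+-suc j j)))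

private
  mixed : ∀ n i j → i + i ≤ n → suc (j + j) ≤ n → ∣ lab n (i + i) - lab n (suc (j + j)) ∣ ≡ n ∸ (i + j)
  mixed n i j p q = cong₂ ∣_-_∣ (lab-even n i p) (lab-odd n j q) ∙ m≤n⇒∣m-n∣≡n∸m i≤ ∙
    ∸-+-assoc n j i ∙ cong (n ∸_) (+-comm j i)
    where
    2[i+j]<2n : suc ((i + j) + (i + j)) ≤ n + n
    2[i+j]<2n = subst (_≤ n + n) (h i j) (+-mono-≤ p q)
      where
      h : ∀ i j → i + i + suc (j + j) ≡ suc ((i + j) + (i + j))
      h = solve-∀
    i+j≤n : i + j ≤ n
    i+j≤n with ≤-total (i + j) n
    ... | inj₁ r = r
    ... | inj₂ r with () ← <-irrefl refl (≤-trans 2[i+j]<2n (+-mono-≤ r r))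
    i≤ : i ≤ n ∸ j
    i≤ = subst (_≤ n ∸ j) (m+n∸n≡m i j) (∸-monoˡ-≤ j i+j≤n)

-- An odd sum forces opposite parities. The positions `2i` and `2j + 1` carry the labels `i` and
-- `n − j`, whose difference is `n − (i + j)`, and `i + j` is the centre.
centre-edge : ∀ {n x y c} → x ≤ n → y ≤ n → Centre x y c → Edge n x y c
centre-edge {n} {x} {y} {c} p q (centre e) = edge p q (h (parityView x) (parityView y) p q e)
  where
  h : ∀ {x y} → ParityView x → ParityView y → x ≤ n → y ≤ n → x + y ≡ suc (c + c) → ∣ lab n x - lab n y ∣ ≡ n ∸ c
  h (even i) (odd j) p q e = mixed n i j p q ∙ cong (n ∸_)
    (double-injective (i + j) c (suc-injective (g i j ∙ e)))
    where
    g : ∀ i j → suc ((i + j) + (i + j)) ≡ i + i + suc (j + j)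
    g = solve-∀
  h (odd i) (even j) p q e = ∣-∣-comm (lab n (suc (i + i))) (lab n (j + j)) ∙ mixed n j i q p ∙ cong (n ∸_)
    (double-injective (j + i) c (suc-injective (g i j ∙ e)))
    where
    g : ∀ i j → suc ((j + i) + (j + i)) ≡ suc (i + i) + (j + j)
    g = solve-∀
  h (even i) (even j) p q e = even-odd-absurd (i + j) c (g i j ∙ e)
    where
    g : ∀ i j → (i + j) + (i + j) ≡ i + i + (j + j)
    g = solve-∀
  h (odd i) (odd j) p q e = even-odd-absurd (suc (i + j)) c (g i j ∙ e)
    where
    g : ∀ i j → suc (i + j) + suc (i + j) ≡ suc (i + i) + suc (j + j)
    g = solve-∀

-- Among positions of one parity the labels are monotone with slope one half, so the difference is
-- `d` whatever `n` is.
chord : ∀ {n c} x d → x + (d + d) ≤ n → d ≡ n ∸ c → Edge n x (x + (d + d)) c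
chord {n} {c} x d p e = edge (m+n≤o⇒m≤o x p) p (h (parityView x) p ∙ e)
  where
  h : ∀ {x} → ParityView x → x + (d + d) ≤ n → ∣ lab n x - lab n (x + (d + d)) ∣ ≡ d
  h (even i) p = cong₂ ∣_-_∣ (lab-even n i (m+n≤o⇒m≤o (i + i) p))
      (cong (lab n) (g i d) ∙ lab-even n (i + d) (subst (_≤ n) (g i d) p)) ∙ ∣m-m+n∣≡n i d
    where
    g : ∀ i d → i + i + (d + d) ≡ (i + d) + (i + d)
    g = solve-∀
  h (odd i) p = cong₂ ∣_-_∣ (lab-odd n i (m+n≤o⇒m≤o (suc (i + i)) p))
      (cong (lab n) (g i d) ∙ lab-odd n (i + d) (subst (_≤ n) (g i d) p)) ∙
      ∸-isometry n (≤-trans (m≤m+n i d) i+d≤n) i+d≤n ∙ ∣m-m+n∣≡n i d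
    where
    g : ∀ i d → suc (i + i) + (d + d) ≡ suc ((i + d) + (i + d))
    g = solve-∀
    i+d≤n : i + d ≤ n
    i+d≤n = ≤-trans (m≤m+n (i + d) (i + d)) (≤-trans (n≤1+n _) (subst (_≤ n) (g i d) p))

-- Graceful layouts and label complement

Graceful : List ℕ → ℕ → ℕ → ℕ → Set
Graceful ls n s t = Layout (Edge n) ls n s t

graceful-≡ : ∀ {ls n n′ s s′ t} → n ≡ n′ → s ≡ s′ → Graceful ls n s t → Graceful ls n′ s′ t
graceful-≡ refl refl G = G

extend : ∀ {ls ls′ n s t ω} → Zigzag ls s t → Graceful ls′ n s ω →
         Graceful (ls ++ ls′) (suc (s + t) + n) s (suc (s + t) + ω)
extend {s = s} {t} = glue (Edge-shift (suc (s + t))) centre-edge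

-- The effect on positions of replacing each label by its complement in `n`: neighbours `2i` and
-- `2i + 1` are exchanged, and the last position is fixed when `n` is even.
mirror : ℕ → ℕ → ℕ
mirror zero          j             = j
mirror (suc zero)    zero          = 1
mirror (suc zero)    (suc j)       = j
mirror (suc (suc n)) zero          = 1
mirror (suc (suc n)) (suc zero)    = 0
mirror (suc (suc n)) (suc (suc j)) = 2 + mirror n j

lab-mirror : ∀ n j → j ≤ n → mirror n j ≤ n × lab n (mirror n j) ≡ n ∸ lab n j
lab-mirror zero          zero          _ = z≤n , refl
lab-mirror (suc zero)    zero          _ = s≤s z≤n , refl
lab-mirror (suc zero)    (suc zero)    _ = z≤n , refl
lab-mirror (suc zero)    (suc (suc j)) (s≤s ())
lab-mirror (suc (suc n)) zero          _ = s≤s z≤n , refl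
lab-mirror (suc (suc n)) (suc zero)    _ = z≤n , sym (n∸n≡0 n)
lab-mirror (suc (suc n)) (suc (suc j)) (s≤s (s≤s p)) with q , e ← lab-mirror n j p =
  s≤s (s≤s q) , (lab-suc-suc n (mirror n j) ∙ cong suc e ∙ sym (+-∸-assoc 1 (lab-≤ n j)) ∙
    cong (2 + n ∸_) (sym (lab-suc-suc n j)))

mirror-↭ : ∀ n → map (mirror n) (range 0 (suc n)) ↭ range 0 (suc n)
mirror-↭ zero          = refl
mirror-↭ (suc zero)    = swap 1 0 refl
mirror-↭ (suc (suc n)) = swap 1 0 (begin
  map (mirror (2 + n)) (range 2 (suc n))
    ≡⟨ cong (map (mirror (2 + n))) (sym (map-+-range 2 0 (suc n))) ∙ sym (map-∘ (range 0 (suc n))) ∙ map-∘ (range 0 (suc n)) ⟩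
  map (2 +_) (map (mirror n) (range 0 (suc n)))  ↭⟨ map⁺ (2 +_) (mirror-↭ n) ⟩
  map (2 +_) (range 0 (suc n))                   ≡⟨ map-+-range 2 0 (suc n) ⟩
  range 2 (suc n)                                ∎)
  where open PermutationReasoning

reflect : ∀ {ls n s t} → Graceful ls n s t → Graceful ls n (mirror n s) (mirror n t)
reflect {n = n} (layout {cv} {cc} {pv} {pc} q p v d) =
  layout (subst (Cycles _ _ _) (map-id cc) (cycles-map (mirror n) (λ c → c) h q))
    (walk-≡ refl refl refl (map-id pc) (walk-map (mirror n) (λ c → c) h p))
    (trans (↭-reflexive (sym (map-++ (mirror n) cv pv))) (trans (map⁺ (mirror n) v) (mirror-↭ n))) d
  where
  h : ∀ {x y c} → Edge n x y c → Edge n (mirror n x) (mirror n y) c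
  h {x} {y} (edge p q e) with p′ , ex ← lab-mirror n x p | q′ , ey ← lab-mirror n y q =
    edge p′ q′ (cong₂ ∣_-_∣ ex ey ∙ ∸-isometry n (lab-≤ n x) (lab-≤ n y) ∙ e)

mirror-odd : ∀ i → mirror (suc (i + i)) (suc (i + i)) ≡ i + i
mirror-odd zero    = refl
mirror-odd (suc i) rewrite +-suc i i = cong (2 +_) (mirror-odd i)

range-cat : ∀ a m {b n xs} → xs ≡ range b n → b ≡ a + m → range a m ++ xs ≡ range a (m + n)
range-cat a m {n = n} refl refl = sym (range-++ a m n)

-- Odd cycles

-- The cycle is the run `l + 1, …, 2l`, closed by a chord of difference `k + 1`. The path descends
-- from `l` to 0, jumps to `2l + 1` and ascends `k` more steps, which makes `n ∸ (l + l)` equal to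
-- `k + 1` and lets the chord take the free index `2l`.
odd-cycle : ∀ k → let l = suc (suc k + suc k); n = suc (l + l) + k in Graceful [ l ] n l n
odd-cycle k = layout
  (add (walk-lift centre-edge (ascend (suc l) (d + d)) (All.++⁻ˡ (range (suc l) l) (All.++⁻ˡ (range (suc l) l ++ []) b)))
    (Edge-sym (chord (suc l) d ≤n (sym (cong (_∸ (l + l)) (sym (+-suc (l + l) k)) ∙ m+n∸m≡n (l + l) (suc k)))))
    (length-range (suc l) l) [])
  (walk-lift centre-edge path (All.++⁻ʳ (range (suc l) l ++ []) b))
  vs cs
  where
  d l n : ℕ
  d = suc k
  l = suc (d + d)
  n = suc (l + l) + k
  path : Walk Centre l n (reverse (range 0 (suc l)) ++ range (suc (l + l)) (suc k))
           (reverse (range 0 l) ++ l ∷ range (suc (l + l)) k)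
  path = join (walk-reverse Centre-sym (ascend 0 l)) (centre refl) (ascend (suc (l + l)) k)
  ≤n : suc l + (d + d) ≤ n
  ≤n = ≤-trans (≤-reflexive (h d)) (≤-trans (n≤1+n (l + l)) (m≤m+n (suc (l + l)) k))
    where
    h : ∀ d → suc (suc (d + d)) + (d + d) ≡ suc (d + d) + suc (d + d)
    h = solve-∀
  vs : (range (suc l) l ++ []) ++ (reverse (range 0 (suc l)) ++ range (suc (l + l)) (suc k)) ↭ range 0 (suc n)
  vs = trans (++⁺ˡ (range (suc l) l ++ []) (++⁺ʳ (range (suc (l + l)) (suc k)) (↭-reverse (range 0 (suc l)))))
    (trans (CM.solve 3 (λ x y z → (y ⊕ CM.id) ⊕ (x ⊕ z) ⊜ x ⊕ (y ⊕ z)) refl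
        (range 0 (suc l)) (range (suc l) l) (range (suc (l + l)) (suc k)))
      (↭-reflexive (range-cat 0 (suc l) (range-cat (suc l) l refl refl) refl ∙ cong (range 0) (h l k))))
    where
    h : ∀ l k → suc l + (l + suc k) ≡ suc (suc (l + l) + k)
    h = solve-∀
  b : All (_≤ n) ((range (suc l) l ++ []) ++ (reverse (range 0 (suc l)) ++ range (suc (l + l)) (suc k)))
  b = bounded vs
  cs : (l + l ∷ range (suc l) (d + d) ++ []) ++ (reverse (range 0 l) ++ l ∷ range (suc (l + l)) k) ↭ range 0 n
  cs = trans (++⁺ˡ (l + l ∷ range (suc l) (d + d) ++ []) (++⁺ʳ (l ∷ range (suc (l + l)) k) (↭-reverse (range 0 l))))
    (trans (CM.solve 5 (λ x y z u v → (v ⊕ (y ⊕ CM.id)) ⊕ (x ⊕ (u ⊕ z)) ⊜ x ⊕ (u ⊕ (y ⊕ (v ⊕ z)))) refl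
        (range 0 l) (range (suc l) (d + d)) (range (suc (l + l)) k) [ l ] [ l + l ])
      (↭-reflexive (range-cat 0 l (range-cat l 1 (range-cat (suc l) (d + d) (range-cat (l + l) 1 refl (+-comm 1 (l + l))) (g d)) (+-comm 1 l)) refl
        ∙ cong (range 0) (h (d + d) l k))))
    where
    g : ∀ d → suc (d + d) + suc (d + d) ≡ suc (suc (d + d)) + (d + d)
    g = solve-∀
    h : ∀ e l k → l + (1 + (e + (1 + k))) ≡ suc (l + suc e) + k
    h = solve-∀

splice : ∀ {R x y z vs ws cs ds} → Walk R x y vs cs → Walk R y z (y ∷ ws) ds → Walk R x z (vs ++ ws) (cs ++ ds)
splice stop       q = q
splice (step r p) q = step r (splice p q)

-- Three forward and one back uses consecutive centres but avoids the position `x + 1` and the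
-- centre `x`. In `odd-stage` that position is the far vertex of the odd cycle, and that centre
-- belongs to the link to the inner layout.
staggered : ∀ x r → ∃[ vs ] Walk Centre x (x + (r + r)) (x ∷ vs) (range (suc x) (r + r)) × vs ↭ range (2 + x) (r + r)
staggered x zero    = [] , walk-≡ refl (sym (+-identityʳ x)) refl refl stop , refl
staggered x (suc r) with vs , p , v ← staggered (2 + x) r =
  3 + x ∷ 2 + x ∷ vs ,
  walk-≡ refl (h x r) refl (cong (λ n → suc x ∷ range (2 + x) n) (sym (+-suc r r)))
    (step (centre (g₁ x)) (step (centre (g₂ x)) p)) ,
  trans (swap _ _ v) (↭-reflexive (cong (λ n → 2 + x ∷ range (3 + x) n) (sym (+-suc r r))))
  where
  h : ∀ x r → 2 + x + (r + r) ≡ x + (suc r + suc r)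
  h = solve-∀
  g₁ : ∀ x → x + (3 + x) ≡ suc (suc x + suc x)
  g₁ = solve-∀
  g₂ : ∀ x → 3 + x + (2 + x) ≡ suc (2 + x + (2 + x))
  g₂ = solve-∀

-- The three strands start at a, a + 1, a + 2, where the strand from a belongs to the path; the zigzag of the
-- path after them starts at b and ends before c.  The last vertex of the odd cycle is x + 1, and the inner
-- layout starts at K.  ε selects which end of the opened cycle gets the edge of equal parity, so that the
-- parity of π + n is arbitrary.
module _ (k t r ε : ℕ) where
  private
    n a b c j x e K : ℕ
    n = 6 + t + k * 3
    a = 2 + n
    b = k * 3 + (3 + a)
    -- The jump between `c` and 0 then has centre `a`. The value of `n` makes `c` also the first
    -- position after the zigzag `zigzag₂ t` placed at `b`.
    c = suc (a + a)
    -- Chosen so that `x + 1` lies at distance `2 (n + 1)` from the end `u` of the opened cycle; its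
    -- sum with the other end `w` is then `4a + 1`, which gives the centre `2a`.
    j = ε + (5 + t + k * 3)
    x = c + j
    e = x + (r + r)
    K = 2 + e

  odd-stage : ∀ {ls π ω u w capv capc} → u ≡ ε + suc a → w + ε ≡ 2 + a →
    Walk Centre w u capv capc → length capv ≡ suc k + suc k →
    capv ↭ strand (1 + a) (suc k) ++ strand (2 + a) (suc k) →
    capc ↭ strand (2 + a) k ++ k * 3 + suc a ∷ strand (3 + a) k →
    ε + suc n ≡ π + (r + r) → Graceful ls n π ω →
    Graceful (suc (suc k + suc k) ∷ ls) (K + n) e (K + ω)
  odd-stage {π = π} {ω} {u} {w} {capv} {capc} refl w≡ capw capl capv↭ capc↭ π≡ (layout {cv} {cc} {pv} {pc} q p v d)
    with layout {pv = zv} {zc} [] z zv↭ zc↭ ← zigzag₂ t | sv , s , sv↭ ← staggered x r =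
    layout (add (step (lift₁ (centre e₃)) (walk-lift lift capw (All.tail (All.++⁻ˡ (suc x ∷ capv) ≤N))))
               (subst (λ y → Edge (K + n) (ε + suc a) y (suc e)) (sym e₁)
                 (chord (ε + suc a) (suc n) (≤-trans (≤-reflexive (sym e₁)) v≤N) (sym (cong (_∸ suc e) (sym (+-suc (suc e) n)) ∙ m+n∸m≡n (suc e) (suc n)))))
               (cong suc capl) (cycles-map (K +_) (K +_) (Edge-shift K) q))
      (join (walk-lift lift outer (All.++⁻ʳ (suc x ∷ capv) ≤N))
        -- The link into the inner layout has centre `x`, the one left out by `staggered`. This
        -- equation is what ties `r` to the inner start `π`.
        (centre-edge z≤N (+-monoʳ-≤ K π≤n) (centre e₄))
        (walk-map (K +_) (K +_) (Edge-shift K) p))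
      (trans (CM.solve 4 (λ α β γ δ → (α ⊕ β) ⊕ (γ ⊕ δ) ⊜ (α ⊕ γ) ⊕ (β ⊕ δ)) refl
                (suc x ∷ capv) (map (K +_) cv) outer-v (map (K +_) pv))
        (trans (↭-reflexive (cong (((suc x ∷ capv) ++ outer-v) ++_) (sym (map-++ (K +_) cv pv))))
          (trans (++-range K (suc n) outer-v↭ v) (↭-reflexive (cong (range 0) (+-suc K n))))))
      (trans (CM.solve 7 (λ α β γ δ ζ η θ → (η ⊕ (θ ⊕ (α ⊕ β))) ⊕ (γ ⊕ (ζ ⊕ δ)) ⊜ (η ⊕ (θ ⊕ (α ⊕ (γ ⊕ ζ)))) ⊕ (β ⊕ δ)) refl
                capc (map (K +_) cc) outer-c (map (K +_) pc) [ x ] [ suc e ] [ a + a ])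
        (trans (↭-reflexive (cong ((suc e ∷ a + a ∷ (capc ++ (outer-c ++ [ x ]))) ++_) (sym (map-++ (K +_) cc pc))))
          (++-range K n outer-c↭ d)))
    where
    tail-v outer-v tail-c outer-c : List ℕ
    tail-v  = range c (suc j) ++ sv
    outer-v = reverse tail-v ++ (range 0 a ++ (strand a (suc k) ++ map (b +_) zv))
    tail-c  = range c j ++ range (suc x) (r + r)
    outer-c = reverse tail-c ++ a ∷ (range 0 (suc n) ++ suc n ∷ (strand (suc a) k ++ k * 3 + (2 + a) ∷ map (b +_) zc))
    tail : Walk Centre c e tail-v tail-c
    tail = splice (ascend c j) s
    -- From `e` the path runs back to `c`, jumps to 0, ascends to `a − 1`, follows the strand from
    -- `a`, and ends with the zigzag at `b`.
    outer : Walk Centre e (b + (3 + t)) outer-v outer-c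
    outer = join (walk-reverse Centre-sym tail) (centre (+-identityʳ c))
      (join (ascend 0 (suc n)) (centre (+-suc (suc n) (suc n)))
        (join (strand-walk a k) (centre (h k a)) (walk-map (b +_) (b +_) (Centre-shift b) z)))
      where
      h : ∀ k a → k * 3 + a + (k * 3 + (3 + a) + 2) ≡ suc (k * 3 + (2 + a) + (k * 3 + (2 + a)))
      h = solve-∀
    c≡ : c ≡ b + suc (2 + (3 + t))
    c≡ = h t k
      where
      h : ∀ t k → suc (8 + t + k * 3 + (8 + t + k * 3)) ≡ k * 3 + (3 + (8 + t + k * 3)) + suc (2 + (3 + t))
      h = solve-∀
    outer-v↭ : (suc x ∷ capv) ++ outer-v ↭ range 0 K
    outer-v↭ = begin
      (suc x ∷ capv) ++ outer-v
        ↭⟨ ++⁺ (prep (suc x) capv↭) (++⁺ (trans (↭-reverse tail-v) (++⁺ˡ (range c (suc j)) sv↭))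
             (++⁺ˡ (range 0 a) (++⁺ˡ (strand a (suc k)) (map⁺ (b +_) zv↭)))) ⟩
      (suc x ∷ strand (1 + a) (suc k) ++ strand (2 + a) (suc k)) ++
        ((range c (suc j) ++ range (2 + x) (r + r)) ++ (range 0 a ++ (strand a (suc k) ++ map (b +_) (range 0 (6 + t)))))
        ↭⟨ CM.solve 8 (λ α β γ δ ζ η θ κ → (θ ⊕ (γ ⊕ δ)) ⊕ ((η ⊕ κ) ⊕ (α ⊕ (β ⊕ ζ))) ⊜ α ⊕ ((β ⊕ (γ ⊕ δ)) ⊕ (ζ ⊕ (η ⊕ (θ ⊕ κ))))) refl
             (range 0 a) (strand a (suc k)) (strand (1 + a) (suc k)) (strand (2 + a) (suc k))
             (map (b +_) (range 0 (6 + t))) (range c (suc j)) [ suc x ] (range (2 + x) (r + r)) ⟩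
      range 0 a ++ ((strand a (suc k) ++ strand (1 + a) (suc k) ++ strand (2 + a) (suc k)) ++
        (map (b +_) (range 0 (6 + t)) ++ (range c (suc j) ++ (suc x ∷ range (2 + x) (r + r)))))
        ↭⟨ ++⁺ˡ (range 0 a) (++⁺ʳ _ (strands-↭ a (suc k))) ⟩
      range 0 a ++ (range a (suc k * 3) ++ (map (b +_) (range 0 (6 + t)) ++ (range c (suc j) ++ range (suc x) (suc (r + r)))))
        ≡⟨ range-cat 0 a (range-cat a (suc k * 3)
             (cong (_++ (range c (suc j) ++ range (suc x) (suc (r + r)))) (map-+-range b 0 (6 + t) ∙ cong (λ y → range y (6 + t)) (+-identityʳ b)) ∙
              range-cat b (6 + t) (range-cat c (suc j) refl (sym (+-suc c j))) c≡) (h₁ k a)) refl ⟩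
      range 0 (a + (suc k * 3 + (6 + t + (suc j + suc (r + r)))))
        ≡⟨ cong (range 0) (h₂ a k t j (r + r) ∙ cong (λ y → y + suc j + suc (r + r)) (sym c≡) ∙ h₃ c j (r + r)) ⟩
      range 0 K ∎
      where
      open PermutationReasoning
      h₁ : ∀ k a → k * 3 + (3 + a) ≡ a + suc k * 3
      h₁ = solve-∀
      h₂ : ∀ a k t j r → a + (suc k * 3 + (6 + t + (suc j + suc r))) ≡ k * 3 + (3 + a) + suc (2 + (3 + t)) + suc j + suc r
      h₂ = solve-∀
      h₃ : ∀ c j r → c + suc j + suc r ≡ 2 + (c + j + r)
      h₃ = solve-∀
    outer-c↭ : suc e ∷ a + a ∷ (capc ++ (outer-c ++ [ x ])) ↭ range 0 K
    outer-c↭ = begin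
      suc e ∷ a + a ∷ (capc ++ (outer-c ++ [ x ]))
        ↭⟨ prep (suc e) (prep (a + a) (++⁺ capc↭ (++⁺ʳ [ x ] (++⁺ (↭-reverse tail-c)
             (prep a (++⁺ˡ (range 0 (suc n)) (prep (suc n) (++⁺ˡ (strand (suc a) k) (prep _ (map⁺ (b +_) zc↭)))))))))) ⟩
      suc e ∷ a + a ∷ ((strand (2 + a) k ++ k * 3 + suc a ∷ strand (3 + a) k) ++
        (((range c j ++ range (suc x) (r + r)) ++ a ∷ (range 0 (suc n) ++ suc n ∷
          (strand (suc a) k ++ k * 3 + (2 + a) ∷ map (b +_) (range 0 (5 + t))))) ++ [ x ]))
        ↭⟨ CM.solve 14 (λ p₁ p₂ p₃ s₁ s₂ s₃ p₇ p₈ p₉ q₁ q₂ q₃ q₄ q₅ →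
             q₅ ⊕ (q₁ ⊕ ((s₂ ⊕ (p₇ ⊕ s₃)) ⊕ (((q₂ ⊕ q₄) ⊕ (p₃ ⊕ (p₁ ⊕ (p₂ ⊕ (s₁ ⊕ (p₈ ⊕ p₉)))))) ⊕ q₃)))
             ⊜ p₁ ⊕ (p₂ ⊕ (p₃ ⊕ ((s₁ ⊕ (s₂ ⊕ s₃)) ⊕ (p₇ ⊕ (p₈ ⊕ (p₉ ⊕ (q₁ ⊕ (q₂ ⊕ (q₃ ⊕ (q₄ ⊕ q₅))))))))))) refl
             (range 0 (suc n)) [ suc n ] [ a ] (strand (suc a) k) (strand (2 + a) k) (strand (3 + a) k)
             [ k * 3 + suc a ] [ k * 3 + (2 + a) ] (map (b +_) (range 0 (5 + t))) [ a + a ] (range c j) [ x ] (range (suc x) (r + r)) [ suc e ] ⟩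
      range 0 (suc n) ++ (suc n ∷ (a ∷ ((strand (suc a) k ++ strand (2 + a) k ++ strand (3 + a) k) ++ (k * 3 + suc a ∷ (k * 3 + (2 + a) ∷
        (map (b +_) (range 0 (5 + t)) ++ (a + a ∷ (range c j ++ (x ∷ (range (suc x) (r + r) ++ [ suc e ])))))))))) 
        ↭⟨ ++⁺ˡ (range 0 (suc n)) (prep _ (prep _ (++⁺ʳ _ (strands-↭ (suc a) k)))) ⟩
      range 0 (suc n) ++ (suc n ∷ (a ∷ (range (suc a) (k * 3) ++ (k * 3 + suc a ∷ (k * 3 + (2 + a) ∷
        (map (b +_) (range 0 (5 + t)) ++ (a + a ∷ (range c j ++ (x ∷ (range (suc x) (r + r) ++ [ suc e ]))))))))) )
        ≡⟨ range-cat 0 (suc n) (range-cat (suc n) 1 (range-cat a 1 (range-cat (suc a) (k * 3) (range-cat (k * 3 + suc a) 1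
             (range-cat (k * 3 + (2 + a)) 1 (cong (_++ (a + a ∷ (range c j ++ (x ∷ (range (suc x) (r + r) ++ [ suc e ])))))
               (map-+-range b 0 (5 + t) ∙ cong (λ y → range y (5 + t)) (+-identityʳ b)) ∙
               range-cat b (5 + t) (range-cat (a + a) 1 (range-cat c j (range-cat x 1 (range-cat (suc x) (r + r) {n = 1} refl refl)
                 (+-comm 1 x)) refl) (+-comm 1 (a + a))) (suc-injective (c≡ ∙ +-suc b (5 + t)))) (h₁ k a)) (h₄ k a)) (+-comm (k * 3) (suc a))) (+-comm 1 a)) (+-comm 1 (suc n))) refl ⟩
      range 0 (suc n + (1 + (1 + (k * 3 + (1 + (1 + (5 + t + (1 + (j + (1 + (r + r + 1)))))))))))
        ≡⟨ cong (range 0) (h₂ n k t j (r + r) ∙ cong (λ y → y + suc j + suc (r + r)) (sym c≡) ∙ h₃ c j (r + r)) ⟩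
      range 0 K ∎
      where
      open PermutationReasoning
      h₁ : ∀ k a → k * 3 + (3 + a) ≡ k * 3 + (2 + a) + 1
      h₁ = solve-∀
      h₄ : ∀ k a → k * 3 + (2 + a) ≡ k * 3 + suc a + 1
      h₄ = solve-∀
      h₂ : ∀ n k t j r → suc n + (1 + (1 + (k * 3 + (1 + (1 + (5 + t + (1 + (j + (1 + (r + 1))))))))))
           ≡ k * 3 + (3 + (2 + n)) + suc (2 + (3 + t)) + suc j + suc r
      h₂ = solve-∀
      h₃ : ∀ c j r → c + suc j + suc r ≡ 2 + (c + j + r)
      h₃ = solve-∀
    N : ℕ
    N = K + n
    ≤N : All (_≤ N) ((suc x ∷ capv) ++ outer-v)
    ≤N = All.map (λ y<K → ≤-trans (<⇒≤ y<K) (m≤m+n K n)) (All-resp-↭ (↭-sym outer-v↭) (range-≤ 0 K))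
    v≤N : suc x ≤ N
    v≤N = All.head ≤N
    lift : ∀ {x y c} → x ≤ N → y ≤ N → Centre x y c → Edge N x y c
    lift = centre-edge
    lift₁ : Centre (suc x) w (a + a) → Edge N (suc x) w (a + a)
    lift₁ = centre-edge v≤N (walk-head capw (All.tail (All.++⁻ˡ (suc x ∷ capv) ≤N)))
    z≤N : b + (3 + t) ≤ N
    z≤N = walk-last outer (All.++⁻ʳ (suc x ∷ capv) ≤N)
    π≤n : π ≤ n
    π≤n = walk-head p (All.++⁻ʳ cv (bounded v))
    e₁ : suc x ≡ ε + suc a + (suc n + suc n)
    e₁ = h t k ε
      where
      h : ∀ t k ε → suc (suc (8 + t + k * 3 + (8 + t + k * 3)) + (ε + (5 + t + k * 3)))
          ≡ ε + suc (8 + t + k * 3) + (suc (6 + t + k * 3) + suc (6 + t + k * 3))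
      h = solve-∀
    e₃ : suc x + w ≡ suc (a + a + (a + a))
    e₃ = h₁ c ε (5 + t + k * 3) w ∙ cong (λ y → suc (c + (5 + t + k * 3) + y)) w≡ ∙ h₂ t k
      where
      h₁ : ∀ c ε m w → suc (c + (ε + m)) + w ≡ suc (c + m + (w + ε))
      h₁ = solve-∀
      h₂ : ∀ t k → suc (suc (8 + t + k * 3 + (8 + t + k * 3)) + (5 + t + k * 3) + (2 + (8 + t + k * 3)))
           ≡ suc (8 + t + k * 3 + (8 + t + k * 3) + (8 + t + k * 3 + (8 + t + k * 3)))
      h₂ = solve-∀
    e₄ : b + (3 + t) + (K + π) ≡ suc (x + x)
    e₄ = h₁ (b + (3 + t)) x (r + r) π ∙ cong (λ y → b + (3 + t) + (2 + x) + y) (sym π≡) ∙ h₂ t k ε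
      where
      h₁ : ∀ z x r π → z + (2 + (x + r) + π) ≡ z + (2 + x) + (π + r)
      h₁ = solve-∀
      h₂ : ∀ t k ε → k * 3 + (3 + (8 + t + k * 3)) + (3 + t) + (2 + (suc (8 + t + k * 3 + (8 + t + k * 3)) + (ε + (5 + t + k * 3)))) + (ε + suc (6 + t + k * 3))
           ≡ suc (suc (8 + t + k * 3 + (8 + t + k * 3)) + (ε + (5 + t + k * 3)) + (suc (8 + t + k * 3 + (8 + t + k * 3)) + (ε + (5 + t + k * 3))))
      h₂ = solve-∀

-- Prescribed path lengths

-- Divide `m` by its gcd with `c` until the two are coprime. A divisor of `m` that is coprime to `c`
-- is coprime to each gcd and so survives every division.
coprime-part : ∀ b m c → m ≤ b → .{{NonZero m}} →
               ∃[ u ] Coprime u c × (∀ {d} → Coprime d c → d ∣ m → d ∣ u)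
coprime-part zero    (suc m) c ()
coprime-part (suc b) m c m≤b with coprime? m c
... | yes m⊥c = m , m⊥c , λ _ d∣m → d∣m
... | no ¬m⊥c with gcd m c in g≡ | gcd[m,n]∣m m c | gcd[m,n]∣n m c
... | 1      | _ | _ = ⊥-elim (¬m⊥c (gcd≡1⇒coprime g≡))
... | 0      | divides q refl | _ = ⊥-elim (≢-nonZero⁻¹ (q * 0) (*-zeroʳ q))
... | g@(2+ _) | divides q@(suc _) refl | g∣c
  with u , u⊥c , h ← coprime-part b q c (s≤s⁻¹ (≤-trans (m<m*n q g (s≤s (s≤s z≤n))) m≤b)) =
  u , u⊥c , λ {d} d⊥c d∣m → h d⊥c (coprime-divisor
    (λ {e} (e∣d , e∣g) → d⊥c {e} (e∣d , ∣-trans e∣g g∣c)) (subst (d ∣_) (*-comm q g) d∣m))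

opaque
  -- With u the part of s prime to c, both u + 2c and c − (u + 2c) (modulo s) are prime to the odd number s.
  sum-of-coprimes : ∀ i c → let s = suc (i + i) in s < c →
                    ∃[ x ] ∃[ y ] suc x + suc y ≡ c × Coprime s (suc x) × Coprime s (suc y)
  sum-of-coprimes i c@(suc c′) s<c
    with u , u⊥c , h ← coprime-part (suc (i + i)) (suc (i + i)) c ≤-refl
    with y , x+y≡c ← m≤n⇒∃[o]m+o≡n (≤-trans (s≤s (m%n<n (u + c′ + c) (suc (i + i)))) s<c) =
    x , y , (+-suc (suc x) y ∙ x+y≡c) ,
    (λ {d} (d∣s , d∣x) → prime-to-s d∣s (subst (d ∣_) (sym a≡) (∣m∣n⇒∣m+n d∣x (∣n⇒∣m*n q d∣s)))) ,
    λ {d} (d∣s , d∣y) → prime-to-s′ d∣s (∣m+n∣m⇒∣n (subst (d ∣_) (sym e) (∣n⇒∣m*n q d∣s)) d∣y)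
    where
    s x q : ℕ
    s = suc (i + i)
    -- Reducing `u + 2c − 1` makes `suc x` the representative of `u + 2c` in `1, …, s`, hence
    -- smaller than `c`.
    x = (u + c′ + c) % s
    q = (u + c′ + c) / s
    h₁ : ∀ u c → c + (u + c) ≡ u + (c + c)
    h₁ = solve-∀
    a≡ : u + (c + c) ≡ suc x + q * s
    a≡ = +-suc u (c′ + c) ∙ cong suc (sym (+-assoc u c′ c) ∙ m≡m%n+[m/n]*n (u + c′ + c) s)
    e : suc y + (u + c) ≡ q * s
    e = +-cancelˡ-≡ (suc x) _ _ (sym (+-assoc (suc x) (suc y) (u + c)) ∙
      cong (_+ (u + c)) (+-suc (suc x) y ∙ x+y≡c) ∙ h₁ u c ∙ a≡)
    prime-to-c : ∀ {d} e → d ∣ u + e → (∀ {f} → f ∣ c → f ∣ e) → Coprime d c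
    prime-to-c {d} e d∣u+e c∣e {f} (f∣d , f∣c) = u⊥c (∣m+n∣m⇒∣n (∣-trans f∣d (subst (d ∣_) (+-comm u e) d∣u+e)) (c∣e f∣c) , f∣c)
    -- A common factor of `d` and `c` would divide `u`, so `d` is coprime to `c`. Then `d` divides
    -- `u`, hence `2c`, hence 2, while `s` is odd.
    prime-to-s : ∀ {d} → d ∣ s → d ∣ u + (c + c) → d ≡ 1
    prime-to-s {d} d∣s d∣a = ∣1⇒≡1 (∣m+n∣m⇒∣n (subst (d ∣_) (+-comm 1 (i + i)) d∣s) (∣-trans d∣2 (divides i (h₂ i))))
      where
      h₂ : ∀ i → i + i ≡ i * 2
      h₂ = solve-∀
      d⊥c : Coprime d c
      d⊥c = prime-to-c (c + c) d∣a (λ f∣c → ∣m∣n⇒∣m+n f∣c f∣c)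
      d∣2 : d ∣ 2
      d∣2 = coprime-divisor d⊥c (subst (d ∣_) (h₂ c) (∣m+n∣m⇒∣n d∣a (h d⊥c d∣s)))
    prime-to-s′ : ∀ {d} → d ∣ s → d ∣ u + c → d ≡ 1
    prime-to-s′ {d} d∣s d∣u+c = d⊥c (∣-refl , ∣m+n∣m⇒∣n d∣u+c (h d⊥c d∣s))
      where
      d⊥c : Coprime d c
      d⊥c = prime-to-c c d∣u+c (λ f∣c → f∣c)

-- Assembling all cycles around an odd core

opaque
  -- The other end of the path stays at the innermost position n throughout.
  add-odd-cycle : ∀ {ls n s l} ((k , _) : OddCycle l) → 6 + k * 3 ≤ n → s ≤ n → Graceful ls n s n →
    ∃[ n′ ] ∃[ s′ ] Graceful (l ∷ ls) n′ s′ n′ × s′ ≤ n′ × n ≤ n′ × 2 + n′ ≤ 7 * (2 + n)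
  add-odd-cycle {ls} {n} {s} (k , refl) k≤n s≤n G
    -- `t` is the surplus room taken up by `zigzag₂`; `d = n + 1 − s`, made even by `ε`, becomes
    -- `r + r`.
    with t , n≡ ← m≤n⇒∃[o]m+o≡n k≤n | d , s+d≡n ← m≤n⇒∃[o]m+o≡n (m≤n⇒m≤1+n s≤n)
    with refl ← cong (6 +_) (+-comm t (k * 3)) ∙ n≡ = go (parityView d) s+d≡n
    where
    bound : ∀ ε d r → ε ≤ 1 → ε + d ≡ r + r → s + d ≡ suc n →
            2 + (2 + (suc (suc (suc n) + suc (suc n)) + (ε + (5 + t + k * 3)) + (r + r)) + n) ≤ 7 * (2 + n)
    bound ε d r ε≤1 e e′ = begin
      2 + (2 + (suc (suc (suc n) + suc (suc n)) + (ε + (5 + t + k * 3)) + (r + r)) + n)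
        ≡⟨ cong (λ y → 2 + (2 + (suc (suc (suc n) + suc (suc n)) + (ε + (5 + t + k * 3)) + y) + n)) (sym e) ∙ h₁ n ε (5 + t + k * 3) d ⟩
      8 + 3 * n + suc (5 + t + k * 3) + (ε + ε) + d
        ≤⟨ +-mono-≤ (+-monoʳ-≤ (8 + 3 * n + n) (+-mono-≤ ε≤1 ε≤1)) (subst (d ≤_) e′ (m≤n+m d s)) ⟩
      8 + 3 * n + n + 2 + suc n  ≤⟨ m≤m+n _ (3 + 2 * n) ⟩
      8 + 3 * n + n + 2 + suc n + (3 + 2 * n)  ≡⟨ h₂ n ⟩
      7 * (2 + n) ∎
      where
      open ≤-Reasoning
      h₁ : ∀ n ε m d → 2 + (2 + (suc (suc (suc n) + suc (suc n)) + (ε + m) + (ε + d)) + n) ≡ 8 + 3 * n + suc m + (ε + ε) + d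
      h₁ = solve-∀
      h₂ : ∀ n → 8 + 3 * n + n + 2 + suc n + (3 + 2 * n) ≡ 7 * (2 + n)
      h₂ = solve-∀
    stage : ∀ ε r {w capv capc} → w + ε ≡ 4 + n → Walk Centre w (ε + (3 + n)) capv capc → length capv ≡ suc k + suc k →
      capv ↭ strand (3 + n) (suc k) ++ strand (4 + n) (suc k) →
      capc ↭ strand (4 + n) k ++ k * 3 + (3 + n) ∷ strand (5 + n) k → ∀ d → ε ≤ 1 → ε + d ≡ r + r → s + d ≡ suc n →
      ∃[ n′ ] ∃[ s′ ] Graceful (suc (suc k + suc k) ∷ ls) n′ s′ n′ × s′ ≤ n′ × n ≤ n′ × 2 + n′ ≤ 7 * (2 + n)
    stage ε r w≡ p len v c d ε≤1 e e′ = 2 + s′ + n , s′ ,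
      odd-stage k t r ε refl w≡ p len v c (cong (ε +_) (sym e′) ∙ h ε s d ∙ cong (s +_) e) G ,
      ≤-trans (m≤n+m s′ 2) (m≤m+n (2 + s′) n) , m≤n+m n (2 + s′) , bound ε d r ε≤1 e e′
      where
      s′ : ℕ
      s′ = suc (suc (suc n) + suc (suc n)) + (ε + (5 + t + k * 3)) + (r + r)
      h : ∀ ε s d → ε + (s + d) ≡ s + (ε + d)
      h = solve-∀
    cap-↭ : (strand (3 + n) (suc k) ++ reverse (strand (4 + n) (suc k))) ↭ strand (3 + n) (suc k) ++ strand (4 + n) (suc k)
    cap-↭ = ++⁺ˡ (strand (3 + n) (suc k)) (↭-reverse (strand (4 + n) (suc k)))
    cap-c↭ : strand (4 + n) k ++ k * 3 + (3 + n) ∷ reverse (strand (5 + n) k) ↭ strand (4 + n) k ++ k * 3 + (3 + n) ∷ strand (5 + n) k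
    cap-c↭ = ++⁺ˡ (strand (4 + n) k) (prep _ (↭-reverse (strand (5 + n) k)))
    go : ∀ {d} → ParityView d → s + d ≡ suc n →
      ∃[ n′ ] ∃[ s′ ] Graceful (suc (suc k + suc k) ∷ ls) n′ s′ n′ × s′ ≤ n′ × n ≤ n′ × 2 + n′ ≤ 7 * (2 + n)
    -- The direction in which `cap` is traversed decides which of `3 + n` and `4 + n` receives the
    -- chord, that is, the value of `ε` required by the parity of `d`.
    go (even r) e = stage 0 r (+-identityʳ (4 + n)) (walk-reverse Centre-sym (cap (3 + n) k))
      (length-reverse (strand (3 + n) (suc k) ++ reverse (strand (4 + n) (suc k))) ∙ length-cap (3 + n) k)
      (trans (↭-reverse _) cap-↭) (trans (↭-reverse _) cap-c↭) (r + r) z≤n refl e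
    go (odd r) e = stage 1 (suc r) (+-comm (3 + n) 1) (cap (3 + n) k) (length-cap (3 + n) k) cap-↭ cap-c↭
      (suc (r + r)) ≤-refl (cong suc (sym (+-suc r r))) e

  -- The longest cycle forms the core, with last position exactly `7 + k * 5`. This exceeds
  -- `6 + j * 3` for every `j ≤ k`, so each further cycle has the room that `add-odd-cycle` asks
  -- for.
  odd-cycles : ∀ {ls} k → All (λ l → Σ (OddCycle l) λ (j , _) → j ≤ k) ls →
    ∃[ n ] ∃[ s ] Graceful (ls ++ [ suc (suc k + suc k) ]) n s n × s ≤ n × 7 + k * 5 ≤ n × 2 + n ≤ 7 ^ length ls * (9 + k * 5)
  odd-cycles k [] = _ , _ , odd-cycle k , ≤-trans (m≤m+n l (suc l)) (≤-trans (≤-reflexive (+-suc l l)) (m≤m+n (suc (l + l)) k)) ,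
    ≤-reflexive (h k) , ≤-reflexive (h′ k)
    where
    l : ℕ
    l = suc (suc k + suc k)
    h : ∀ k → 7 + k * 5 ≡ suc (suc (suc k + suc k) + suc (suc k + suc k)) + k
    h = solve-∀
    h′ : ∀ k → 2 + (suc (suc (suc k + suc k) + suc (suc k + suc k)) + k) ≡ 1 * (9 + k * 5)
    h′ = solve-∀
  odd-cycles {_ ∷ ls} k ((o@(j , _) , j≤k) ∷ os) with n , s , G , s≤n , k≤n , n≤ ← odd-cycles k os
    with n′ , s′ , G′ , s′≤n′ , n≤n′ , n′≤ ← add-odd-cycle o
           (≤-trans (+-mono-≤ (n≤1+n 6) (≤-trans (*-monoˡ-≤ 3 j≤k) (*-monoʳ-≤ k (m≤m+n 3 2)))) k≤n) s≤n G =
    n′ , s′ , G′ , s′≤n′ , ≤-trans k≤n n≤n′ ,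
    ≤-trans n′≤ (≤-trans (*-monoʳ-≤ 7 n≤) (≤-reflexive (sym (*-assoc 7 (7 ^ length ls) (9 + k * 5)))))

  -- A `spiral s` adds `s + 1 ≤ n + 1` positions and is glued on only when the target has caught up
  -- with `n′`, so the overshoot never exceeds `n`.
  grow : ∀ {ls n s} → s ≤ n → Graceful ls n s n → ∀ m → ∃[ n′ ] Graceful ls n′ s n′ × m ≤ n′ × n′ ≤ m + n
  grow {n = n} s≤n G zero = n , G , z≤n , ≤-refl
  grow {n = n} {s} s≤n G (suc m) with n′ , G′ , m≤n′ , n′≤ ← grow s≤n G m with m≤n⇒m<n∨m≡n m≤n′
  ... | inj₁ m<n′ = n′ , G′ , m<n′ , m≤n⇒m≤1+n n′≤
  ... | inj₂ refl = _ , extend (spiral s) G′ , s≤s (m≤n+m m (s + 0)) ,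
    s≤s (≤-trans (+-monoˡ-≤ m (≤-trans (≤-reflexive (+-identityʳ s)) s≤n)) (≤-reflexive (+-comm n m)))

  -- Reversal starts the path at `n`, and for odd `n` the label complement moves this start to
  -- `n − 1`. An even start gives `lengthen` an odd modulus.
  innermost-end : ∀ {ls n s} → Graceful ls n s n → ∃[ i ] ∃[ t ] Graceful ls n (i + i) t × i + i ≤ n × n ≤ suc (i + i)
  innermost-end {ls} {n} G with parityView n | layout-reverse Edge-sym G
  ... | even i | G′ = i , _ , G′ , ≤-refl , n≤1+n _
  ... | odd i  | G′ = i , _ , graceful-≡ refl (mirror-odd i) (reflect G′) , n≤1+n _ , ≤-refl

  -- With `s = i + i`, zigzags with far ends `x` and `y` add `(x + 1) + (y + 1) + 2s` positions. The
  -- bound on `K` leaves `(x + 1) + (y + 1)` above the modulus `s + 1`, as `sum-of-coprimes`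
  -- requires.
  lengthen : ∀ {ls n i t} K → 3 * suc (i + i) ≤ K → Graceful ls n (i + i) t → ∃[ t′ ] Graceful ls (K + n) (i + i) t′
  lengthen {n = n} {i} K 3s≤K G with d , refl ← m≤n⇒∃[o]m+o≡n 3s≤K
    with x , y , x+y≡ , cx , cy ← sum-of-coprimes i (suc (i + i) + 2 + d) (s≤s (≤-trans (≤-reflexive (+-comm 1 (i + i))) (≤-trans (+-monoʳ-≤ (i + i) (s≤s z≤n)) (m≤m+n (i + i + 2) d)))) =
    _ , graceful-≡ (h₁ (i + i) x y n ∙ cong (λ z → z + (i + i + (i + i)) + n) x+y≡ ∙ h₂ (i + i) d n) refl
      (extend (zigzag-coprime _ (i + i) x ≤-refl cx) (extend (zigzag-coprime _ (i + i) y ≤-refl cy) G))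
    where
    h₁ : ∀ s x y n → suc (s + x) + (suc (s + y) + n) ≡ suc x + suc y + (s + s) + n
    h₁ = solve-∀
    h₂ : ∀ s d n → suc s + 2 + d + (s + s) + n ≡ 3 * suc s + d + n
    h₂ = solve-∀

  add-even-cycles : ∀ {ls evs n i t} → All EvenCycle evs → 3 + 2 * sum evs ≤ i + i → Graceful ls n (i + i) t →
    ∃[ t′ ] Graceful (evs ++ ls) (3 + (i + i) + n) (i + i) t′
  add-even-cycles {evs = evs} {n} {i} es b G with d , i≡ ← m≤n⇒∃[o]m+o≡n b =
    _ , graceful-≡ (cong (λ m → suc m + n) (+-comm (i + i) 2)) refl
      (extend (flip (subst (Zigzag evs 2) i≡ (even-cycles es d))) G)

  room : ∀ {i n′ e n} → i + i ≤ n′ → n′ ≤ 4 + 2 * e + n → 3 + (i + i) + n′ + 3 * suc (i + i) ≤ 26 + 10 * e + 5 * n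
  room {i} {n′} {e} {n} i≤ n′≤ = begin
    3 + (i + i) + n′ + 3 * suc (i + i)  ≤⟨ +-mono-≤ (+-monoˡ-≤ n′ (+-monoʳ-≤ 3 i≤)) (*-monoʳ-≤ 3 (s≤s i≤)) ⟩
    3 + n′ + n′ + 3 * suc n′            ≡⟨ h₁ n′ ⟩
    6 + 5 * n′                          ≤⟨ +-monoʳ-≤ 6 (*-monoʳ-≤ 5 n′≤) ⟩
    6 + 5 * (4 + 2 * e + n)             ≡⟨ h₂ e n ⟩
    26 + 10 * e + 5 * n                 ∎
    where
    open ≤-Reasoning
    h₁ : ∀ n → 3 + n + n + 3 * suc n ≡ 6 + 5 * n
    h₁ = solve-∀
    h₂ : ∀ e n → 6 + 5 * (4 + 2 * e + n) ≡ 26 + 10 * e + 5 * n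
    h₂ = solve-∀

graceful-layout : ∀ {evs ods n s} N → All EvenCycle evs → s ≤ n → Graceful ods n s n →
  26 + 10 * sum evs + 5 * n ≤ N → ∃[ s′ ] ∃[ t′ ] Graceful (evs ++ ods) N s′ t′
graceful-layout {evs} {ods} {n} N es s≤n G n≤N
  -- One more than the `3 + 2 * sum evs` that the even cycles need, since `innermost-end` may lose
  -- one.
  with n′ , G′ , m≤n′ , n′≤ ← grow s≤n G (4 + 2 * sum evs)
  with i , _ , G″ , i≤n′ , n′≤i ← innermost-end G′
  with _ , H ← add-even-cycles {i = i} es (s≤s⁻¹ (≤-trans m≤n′ n′≤i)) G″
  with K , K≡ ← m≤n⇒∃[o]m+o≡n (≤-trans (room {i} {n′} {sum evs} {n} i≤n′ n′≤) n≤N)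
  with _ , H′ ← lengthen {i = i} (3 * suc (i + i) + K) (m≤m+n _ K) H =
  _ , _ , graceful-≡ (h₃ (3 + (i + i) + n′) (3 * suc (i + i)) K ∙ K≡) refl H′
  where
  h₃ : ∀ a b K → b + K + a ≡ a + b + K
  h₃ = solve-∀

-- Layouts as graceful labelings

applyUpTo-range : ∀ {f} a n → (∀ i → f i ≡ a + i) → applyUpTo f n ≡ range a n
applyUpTo-range a zero    h = refl
applyUpTo-range a (suc n) h = cong₂ _∷_ (h 0 ∙ +-identityʳ a) (applyUpTo-range (suc a) n (λ i → h (suc i) ∙ +-suc a i))

↭-range⇒Unique : ∀ {xs n} → xs ↭ range 0 n → Unique xs
↭-range⇒Unique {n = n} p = Permutation.Unique-resp-↭ (setoid ℕ) (↭⇒↭ₛ (↭-sym p))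
  (subst Unique (applyUpTo-range 0 n (λ _ → refl)) (upTo⁺ n))

walk-diffs : ∀ {n x y vs cs} → Walk (Edge n) x y vs cs → pathDiffs (map (lab n) vs) ≡ map (n ∸_) cs
walk-diffs stop                               = refl
walk-diffs (step (edge _ _ e) stop)           = cong (_∷ []) e
walk-diffs (step (edge _ _ e) p@(step _ _))   = cong₂ _∷_ e (walk-diffs p)

cycle-diffs : ∀ {n x y c vs cs} → Walk (Edge n) x y vs cs → Edge n y x c →
              cycleDiffs (map (lab n) vs) ↭ map (n ∸_) (c ∷ cs)
cycle-diffs {n} {x} {c = c} {vs} {cs} p r = trans (↭-reflexive (closed p ∙ walk-diffs (join p r stop)))
  (map⁺ (n ∸_) (++-comm cs [ c ]))
  where
  closed : ∀ {x y vs cs} → Walk (Edge n) x y vs cs → cycleDiffs (map (lab n) vs) ≡ pathDiffs (map (lab n) (vs ++ [ x ]))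
  closed stop                            = refl
  closed {x} (step {vs = vs} _ _) = cong pathDiffs (sym (map-++ (lab n) (x ∷ vs) [ x ]))

vector : ∀ {l} (xs : List ℕ) → length xs ≡ l → ∃[ v ] toList {n = l} v ≡ xs
vector xs refl = fromList xs , toList∘fromList xs

cycle-labels : ∀ {n} s (ℓ : Fin s → ℕ) {vs cs} → Cycles (Edge n) (values ℓ) vs cs →
  Σ ((i : Fin s) → Vec ℕ (ℓ i)) λ C →
    concat (VF.toList (λ i → toList (C i))) ≡ map (lab n) vs ×
    concat (VF.toList (λ i → cycleDiffs (toList (C i)))) ↭ map (n ∸_) cs
cycle-labels zero ℓ [] = (λ ()) , refl , refl
cycle-labels {n} (suc s) ℓ (add {c = c} {vs = vs} {cs} {ws = ws} {ds} p r e q)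
  with C , labels , diffs ← cycle-labels s (ℓ ∘ Fin.suc) q
  with v , v≡ ← vector (map (lab n) vs) (length-map (lab n) vs ∙ e) =
  (λ { Fin.zero → v ; (Fin.suc i) → C i }) ,
  (cong₂ _++_ v≡ labels ∙ sym (map-++ (lab n) vs ws)) ,
  trans (++⁺ (trans (↭-reflexive (cong cycleDiffs v≡)) (cycle-diffs p r)) diffs)
    (↭-reflexive (sym (map-++ (n ∸_) (c ∷ cs) ds)))

length-cycles : ∀ {R ls vs cs} → Cycles R ls vs cs → length vs ≡ sum ls
length-cycles [] = refl
length-cycles (add {vs = vs} p r e q) = length-++ vs ∙ cong₂ _+_ e (length-cycles q)

graceful-labeling : ∀ s ℓ m {x y} → Graceful (values ℓ) (numEdges s ℓ m) x y → HasGracefulLabeling s ℓ m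
graceful-labeling s ℓ m (layout {cv} {cc} {pv} {pc} q p v d)
  with C , labels , diffs ← cycle-labels s ℓ q
  -- The path has `m + 1` vertices by counting: all positions less those on the cycles.
  with P , P≡ ← vector (map (lab (numEdges s ℓ m)) pv) (length-map (lab (numEdges s ℓ m)) pv ∙
         +-cancelˡ-≡ (sum (values ℓ)) _ _ (cong (_+ length pv) (sym (length-cycles q)) ∙ sym (length-++ cv) ∙
           ↭-length v ∙ length-range 0 (suc (numEdges s ℓ m)) ∙ sym (+-suc (sum (values ℓ)) m))) =
  C , P , ↭-range⇒Unique labels↭ , bounded labels↭ ,
  trans (++⁺ diffs (↭-reflexive (cong pathDiffs P≡ ∙ walk-diffs p)))
    (trans (↭-reflexive (sym (map-++ (N ∸_) cc pc)))
      (trans (map⁺ (N ∸_) d) (trans (∸-↭ N) (↭-reflexive (sym (map-applyUpTo (λ i → i) suc N ∙ applyUpTo-range 1 N (λ _ → refl)))))))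
  where
  N : ℕ
  N = numEdges s ℓ m
  labels↭ : allLabels s ℓ m C P ↭ range 0 (suc N)
  labels↭ = trans (↭-reflexive (cong₂ _++_ labels P≡ ∙ sym (map-++ (lab N) cv pv))) (trans (map⁺ (lab N) v) (lab-↭ N))

-- Splitting by parity and numerical budgets

isEven-even : ∀ i → isEven (i + i) ≡ true
isEven-even i = cong (_≡ᵇ 0) (cong (_% 2) (h i) ∙ [m+kn]%n≡m%n 0 i 2)
  where
  h : ∀ i → i + i ≡ 0 + i * 2
  h = solve-∀

isEven-odd : ∀ i → isEven (suc (i + i)) ≡ false
isEven-odd i = cong (_≡ᵇ 0) (cong (_% 2) (h i) ∙ [m+kn]%n≡m%n 1 i 2)
  where
  h : ∀ i → suc (i + i) ≡ 1 + i * 2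
  h = solve-∀

split-parity : ∀ {ls} → All (3 ≤_) ls →
  All EvenCycle (filterᵇ isEven ls) × All OddCycle (filterᵇ (λ n → not (isEven n)) ls) ×
  filterᵇ isEven ls ++ filterᵇ (λ n → not (isEven n)) ls ↭ ls
split-parity [] = [] , [] , refl
split-parity {l ∷ ls} (3≤l ∷ 3≤ls) with es , os , π ← split-parity 3≤ls with parityView l
... | even i rewrite isEven-even i = h i 3≤l ∷ es , os , prep _ π
  where
  h : ∀ i → 3 ≤ i + i → EvenCycle (i + i)
  h (suc zero)    (s≤s (s≤s ()))
  h (suc (suc k)) _ = k , refl
... | odd i rewrite isEven-odd i = es , h i 3≤l ∷ os ,
    trans (shift _ (filterᵇ isEven ls) (filterᵇ (λ n → not (isEven n)) ls)) (prep _ π)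
  where
  h : ∀ i → 3 ≤ suc (i + i) → OddCycle (suc (i + i))
  h zero    (s≤s ())
  h (suc k) _ = k , refl

≤-maxList : ∀ xs → All (_≤ maxList xs) xs
≤-maxList []       = []
≤-maxList (x ∷ xs) = m≤m⊔n x (maxList xs) ∷ All.map (λ y≤ → ≤-trans y≤ (m≤n⊔m x (maxList xs))) (≤-maxList xs)

-- The maximum goes to the end of the list because `odd-cycles` keeps its core there.
largest-first : ∀ x xs → ∃[ y ] ∃[ ys ] ys ++ [ y ] ↭ x ∷ xs × All (_≤ y) ys
largest-first x [] = x , [] , refl , []
largest-first x (x′ ∷ xs) with y , ys , π , ys≤ ← largest-first x′ xs with ≤-total x y
... | inj₁ x≤y = y , x ∷ ys , prep x π , x≤y ∷ ys≤
... | inj₂ y≤x = x , ys ++ [ y ] , trans (++-comm (ys ++ [ y ]) [ x ]) (prep x π) ,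
  All.++⁺ (All.map (λ z≤y → ≤-trans z≤y y≤x) ys≤) (y≤x ∷ [])

sum-bound : ∀ ls b → All (λ l → l + 3 ≤ b) ls → sum ls + 3 * length ls ≤ length ls * b
sum-bound [] b [] = z≤n
sum-bound (l ∷ ls) b (l≤ ∷ ls≤) = begin
  l + sum ls + 3 * suc (length ls)      ≡⟨ h l (sum ls) (length ls) ⟩
  l + 3 + (sum ls + 3 * length ls)      ≤⟨ +-mono-≤ l≤ (sum-bound ls b ls≤) ⟩
  b + length ls * b                     ∎
  where
  open ≤-Reasoning
  h : ∀ l s n → l + s + 3 * suc n ≡ l + 3 + (s + 3 * n)
  h = solve-∀

-- Without even cycles both sides are 6. Otherwise `12 (sum evs + 3 * length evs)` is at most
-- `6 * (2 * length evs * b)`, and its constant part of at least 36 pays for the 6 and for the 1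
-- subtracted in `m₀`.
even-budget : ∀ evs → let b = maxList (map (λ n → n + 3) evs) in
  9 * sum evs + 6 ≤ 6 * (1 ⊔ (2 * length evs * b ∸ 1))
even-budget [] = ≤-refl
even-budget evs@(_ ∷ es) = ≤-trans (+-cancelʳ-≤ 6 _ _ (begin
    9 * sum evs + 6 + 6               ≤⟨ m≤m+n _ (3 * sum evs + 24) ⟩
    9 * sum evs + 6 + 6 + (3 * sum evs + 24)  ≡⟨ h₁ (sum evs) ⟩
    12 * (sum evs + 3 * 1)            ≤⟨ *-monoʳ-≤ 12 (+-monoʳ-≤ (sum evs) (*-monoʳ-≤ 3 (s≤s (z≤n {length es})))) ⟩
    12 * (sum evs + 3 * length evs)   ≤⟨ *-monoʳ-≤ 12 (sum-bound evs b (All.map⁻ (≤-maxList (map (λ n → n + 3) evs)))) ⟩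
    12 * (length evs * b)             ≡⟨ h₂ (length evs) b ⟩
    6 * (2 * length evs * b)          ≤⟨ *-monoʳ-≤ 6 (m≤n+m∸n (2 * length evs * b) 1) ⟩
    6 * (1 + c)                       ≡⟨ h₃ c ⟩
    6 * c + 6                         ∎))
  (*-monoʳ-≤ 6 (m≤n⊔m 1 c))
  where
  open ≤-Reasoning
  b c : ℕ
  b = maxList (map (λ n → n + 3) evs)
  c = 2 * length evs * b ∸ 1
  h₁ : ∀ s → 9 * s + 6 + 6 + (3 * s + 24) ≡ 12 * (s + 3 * 1)
  h₁ = solve-∀
  h₂ : ∀ n b → 12 * (n * b) ≡ 6 * (2 * n * b)
  h₂ = solve-∀
  h₃ : ∀ c → 6 * (1 + c) ≡ 6 * c + 6
  h₃ = solve-∀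

index-≤ : ∀ k {l} → OddCycle l × l ≤ suc (suc k + suc k) → Σ (OddCycle l) λ (j , _) → j ≤ k
index-≤ k ((j , refl) , l≤) = (j , refl) , ≮⇒≥ λ k<j → <⇒≱ (+-mono-< (s≤s k<j) (s≤s k<j)) (s≤s⁻¹ l≤)

-- For the longest odd length `y = 2k + 3`, `5 * (9 + k * 5)` stays below `7 * (2 * y + 1)`; the one
-- unit still missing comes from `sum ods`. Without odd cycles the core is a single vertex and
-- `11 ≤ 7 * 3`.
odd-layout : ∀ {ods} → All OddCycle ods →
  ∃[ ls ] ∃[ n ] ∃[ s ] Graceful ls n s n × ls ↭ ods × s ≤ n ×
    11 + 5 * n ≤ sum ods + 7 * (3 ⊔ (7 ^ (length ods ∸ 1) * maxList (map (λ n → 2 * n + 1) ods)))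
odd-layout [] = [] , 0 , 0 , layout [] stop refl refl , refl , z≤n , m≤m+n 11 10
odd-layout {ods@(o ∷ os)} os-odd with largest-first o os
... | y , ys , π , ys≤y with os′ ← All-resp-↭ (↭-sym π) os-odd with (k , refl) ∷ [] ← All.++⁻ʳ ys os′
  with n , s , G , s≤n , _ , n≤ ← odd-cycles {ys} k (All.zipWith (index-≤ k) (All.++⁻ˡ ys os′ , ys≤y)) =
  ys ++ [ y ] , n , s , G , π , s≤n , (begin
    11 + 5 * n                         ≡⟨ h₁ n ⟩
    1 + 5 * (2 + n)                    ≤⟨ +-mono-≤ 1≤sum (*-monoʳ-≤ 5 n≤) ⟩
    sum ods + 5 * (7 ^ length ys * (9 + k * 5))  ≡⟨ cong (sum ods +_) (h₂ (7 ^ length ys) (9 + k * 5)) ⟩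
    sum ods + 7 ^ length ys * (5 * (9 + k * 5))
      ≤⟨ +-monoʳ-≤ (sum ods) (*-monoʳ-≤ (7 ^ length ys) (≤-trans (m≤m+n (5 * (9 + k * 5)) (4 + k * 3)) (≤-reflexive (h₃ k)))) ⟩
    sum ods + 7 ^ length ys * (7 * (2 * y + 1))  ≡⟨ cong (sum ods +_) (h₄ (7 ^ length ys) (2 * y + 1)) ⟩
    sum ods + 7 * (7 ^ length ys * (2 * y + 1))
      ≤⟨ +-monoʳ-≤ (sum ods) (*-monoʳ-≤ 7 (*-mono-≤ (≤-reflexive (cong (7 ^_) length-ys)) y≤max)) ⟩
    sum ods + 7 * (7 ^ length os * maxList (map (λ n → 2 * n + 1) ods))
      ≤⟨ +-monoʳ-≤ (sum ods) (*-monoʳ-≤ 7 (m≤n⊔m 3 (7 ^ length os * maxList (map (λ n → 2 * n + 1) ods)))) ⟩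
    sum ods + 7 * (3 ⊔ (7 ^ length os * maxList (map (λ n → 2 * n + 1) ods))) ∎)
  where
  open ≤-Reasoning
  length-ys : length ys ≡ length os
  length-ys = suc-injective (+-comm 1 (length ys) ∙ sym (length-++ ys) ∙ ↭-length π)
  y≤max : 2 * y + 1 ≤ maxList (map (λ n → 2 * n + 1) ods)
  y≤max = All.head (All.++⁻ʳ ys (All-resp-↭ (↭-sym π) (All.map⁻ (≤-maxList (map (λ n → 2 * n + 1) ods)))))
  1≤sum : 1 ≤ sum ods
  1≤sum = ≤-trans (s≤s z≤n) (≤-trans (m≤n+m (y + 0) (sum ys)) (≤-reflexive (sym (sum-++ ys [ y ]) ∙ sum-↭ π)))
  h₁ : ∀ n → 11 + 5 * n ≡ 1 + 5 * (2 + n)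
  h₁ = solve-∀
  h₂ : ∀ p q → 5 * (p * q) ≡ p * (5 * q)
  h₂ = solve-∀
  h₃ : ∀ k → 5 * (9 + k * 5) + (4 + k * 3) ≡ 7 * (2 * suc (suc k + suc k) + 1)
  h₃ = solve-∀
  h₄ : ∀ p q → p * (7 * q) ≡ 7 * (p * q)
  h₄ = solve-∀

-- Of the `10 * e` needed, `9 * e` is paid by the path and `e` by the edges of the even cycles
-- themselves; the constant is `26 = 6 + 11 + 9`.
total-budget : ∀ {e o n A B m} → 9 * e + 6 ≤ 6 * A → 11 + 5 * n ≤ o + 7 * B → 6 * A + 7 * B + 9 ≤ m →
               26 + 10 * e + 5 * n ≤ e + o + m
total-budget {e} {o} {n} {A} {B} {m} even≤ odd≤ m≥ = begin
  26 + 10 * e + 5 * n                       ≡⟨ h₁ e n ⟩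
  e + (9 * e + 6) + (11 + 5 * n) + 9        ≤⟨ +-monoˡ-≤ 9 (+-mono-≤ (+-monoʳ-≤ e even≤) odd≤) ⟩
  e + 6 * A + (o + 7 * B) + 9               ≡⟨ h₂ e A o B ⟩
  e + o + (6 * A + 7 * B + 9)               ≤⟨ +-monoʳ-≤ (e + o) m≥ ⟩
  e + o + m                                 ∎
  where
  open ≤-Reasoning
  h₁ : ∀ e n → 26 + 10 * e + 5 * n ≡ e + (9 * e + 6) + (11 + 5 * n) + 9
  h₁ = solve-∀
  h₂ : ∀ e A o B → e + 6 * A + (o + 7 * B) + 9 ≡ e + o + (6 * A + 7 * B + 9)
  h₂ = solve-∀

length-oddLens : ∀ {s} (ℓ : Fin s → ℕ) → evenLens ℓ ++ oddLens ℓ ↭ values ℓ →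
                 length (oddLens ℓ) ≡ s ∸ length (evenLens ℓ)
length-oddLens ℓ π = sym (m+n∸m≡n (length (evenLens ℓ)) (length (oddLens ℓ))) ∙
  cong (_∸ length (evenLens ℓ)) (sym (length-++ (evenLens ℓ)) ∙ ↭-length π ∙ length-tabulate ℓ)

theorem1p5 : (s : ℕ) (ℓ : Fin s → ℕ) (m : ℕ) →
    (∀ i → 3 ≤ ℓ i) →
    6 * (1 ⊔ m₀ s ℓ) + 7 * (3 ⊔ m₁ s ℓ) + 9 ≤ m →
    HasGracefulLabeling s ℓ m
theorem1p5 s ℓ m 3≤ℓ m≥ =
  let evens , odds , π = split-parity (All.tabulate⁺ 3≤ℓ)
      _ , n , _ , G , ls↭ , t≤n , n≤ = odd-layout odds
      -- Isolates the number of odd cycles, so that it can be rewritten as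
      -- `s ∸ length (evenLens ℓ)`, the form it has in `m₁`.
      B = λ o → 3 ⊔ (7 ^ (o ∸ 1) * maxList (map (λ n → 2 * n + 1) (oddLens ℓ)))
      n≤′ = subst (λ o → 11 + 5 * n ≤ sum (oddLens ℓ) + 7 * B o) (length-oddLens ℓ π) n≤
      N≥ = total-budget {sum (evenLens ℓ)} {sum (oddLens ℓ)} {n} {1 ⊔ m₀ s ℓ} {3 ⊔ m₁ s ℓ} {m}
             (even-budget (evenLens ℓ)) n≤′ m≥
      N≥′ = subst (λ a → 26 + 10 * sum (evenLens ℓ) + 5 * n ≤ a + m)
              (sym (sum-++ (evenLens ℓ) (oddLens ℓ)) ∙ sum-↭ π) N≥
      _ , _ , H = graceful-layout (numEdges s ℓ m) evens t≤n G N≥′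
  in graceful-labeling s ℓ m (layout-↭ (trans (++⁺ˡ (evenLens ℓ) ls↭) π) H)
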